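{- Let $d\ge 3$ and let $h$ be a $d$-uniform hypergraph that is a preimage of an ambiguous graph. Then $d-1-\frac{1}{m(h)}\ge\frac{2d-4}{2d-1}$.
   Context: For a $d$-uniform hypergraph $H$, $\mathrm{Proj}(H)$ is the graph on the same vertex set with $\{i,j\}$ an edge iff some hyperedge contains $\{i,j\}$; $H$ is a preimage of a graph $G$ if $\mathrm{Proj}(H)=G$. A minimal preimage of $G$ is a preimage with the minimum number of hyperedges; $G$ is ambiguous if it has at least two distinct minimal preimages. For a hypergraph $K$, $\alpha(K)=e(K)/v(K)$ (hyperedges over vertices) and $m(H)=\max_{K\subseteq H}\alpha(K)$ over subhypergraphs $K$ of $H$. -}

module Defs where

open import Data.Nat using (ℕ; NonZero)
open import Data.Fin using (Fin)
open import Data.Fin.Subset using (Subset; _∈_; _⊆_; ∣_∣)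
open import Data.List using (List; length)
open import Data.List.Relation.Unary.All using (All)
open import Data.List.Relation.Unary.Unique.Propositional using (Unique)
import Data.List.Membership.Propositional as LM
open import Data.Product using (Σ; _×_; ∃)
open import Data.Integer using (+_)
open import Data.Rational using (ℚ; _/_)
open import Relation.Nullary using (¬_)
open import Relation.Binary.PropositionalEquality using (_≡_; _≢_)
open import Function.Bundles using (_⇔_)

record Hypergraph (n : ℕ) : Set where
  constructor hyp
  field
    edges  : List (Subset n)
    unique : Unique edges
open Hypergraph public

e : ∀ {n} → Hypergraph n → ℕ
e H = length (edges H)

Uniform : ℕ → ∀ {n} → Hypergraph n → Set
Uniform d H = All (λ f → ∣ f ∣ ≡ d) (edges H)

record Graph (n : ℕ) : Set₁ where
  field
    Adj : Fin n → Fin n → Set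
open Graph public

ProjAdj : ∀ {n} → Hypergraph n → Fin n → Fin n → Set
ProjAdj H i j = (i ≢ j) × ∃ λ f → (f LM.∈ edges H) × (i ∈ f) × (j ∈ f)

Preimage : ℕ → ∀ {n} → Hypergraph n → Graph n → Set
Preimage d H G = Uniform d H × (∀ i j → Adj G i j ⇔ ProjAdj H i j)

MinimalPreimage : ℕ → ∀ {n} → Hypergraph n → Graph n → Set
MinimalPreimage d H G =
  Preimage d H G × (∀ (H' : Hypergraph _) → Preimage d H' G → e H Data.Nat.≤ e H')

SameHypergraph : ∀ {n} → Hypergraph n → Hypergraph n → Set
SameHypergraph H₁ H₂ = ∀ f → (f LM.∈ edges H₁) ⇔ (f LM.∈ edges H₂)

Ambiguous : ℕ → ∀ {n} → Graph n → Set
Ambiguous d G = Σ (Hypergraph _) λ H₁ → Σ (Hypergraph _) λ H₂ →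
  MinimalPreimage d H₁ G × MinimalPreimage d H₂ G × ¬ SameHypergraph H₁ H₂

record SubHypergraph {n : ℕ} (H : Hypergraph n) : Set where
  field
    verts       : Subset n
    kedges      : List (Subset n)
    kunique     : Unique kedges
    kedges⊆     : All (λ f → f LM.∈ edges H) kedges
    kedgesIn    : All (λ f → f ⊆ verts) kedges
    nonempty    : NonZero ∣ verts ∣
open SubHypergraph public

α : ∀ {n} {H : Hypergraph n} → SubHypergraph H → ℚ
α K = ((+ length (kedges K)) / ∣ verts K ∣) {{nonempty K}}

IsMaxDensity : ∀ {n} → Hypergraph n → ℚ → Set
IsMaxDensity H q =
  (∃ λ (K : SubHypergraph H) → α K ≡ q) × (∀ (K : SubHypergraph H) → α K Data.Rational.≤ q)

{-# OPTIONS --safe #-}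
{-
Remove from h every hyperedge all of whose pairs are covered by other hyperedges;
this only removes subhypergraphs. Ambiguity then provides a minimal preimage H ≠ h.
Let X be the union of the hyperedges lying in exactly one of h and H, let A and B be
the hyperedges of h and of H inside X, and T those meeting X in at least two vertices
but not contained in X; h and H share T, and |B| ≤ |A|. The subhypergraph A ∪ T of h
is dense enough, by discharging on X: each vertex demands 2(2d - 1), a hyperedge of T
meeting X in s vertices pays 3(s - 1) to each of them, and every member of A and of B
pays a total of at most 2d² - 5d + 5. The last point is local. Since h and H have the
same projection, at each vertex of X the pairs covered by A but not by B, or
conversely, are covered by T; so a vertex in few members of A and B lies in many
T-pairs and demands little. Equality occurs for two d-sets sharing d - 1 vertices, one
being the unique member of A and the other of B, with every pair of a shared and an
unshared vertex in its own member of T.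
-}
module Submission where

open import Defs
open import Data.Nat hiding (∣_-_∣)
open import Data.Nat.Properties
open import Data.Nat.Tactic.RingSolver using (solve-∀)
import Data.Bool.Properties as Bool
open import Data.Bool using (true; false; if_then_else_)
open import Data.Fin using (Fin; zero; suc)
import Data.Fin.Properties as Fin
open import Data.Fin.Subset
open import Data.Fin.Subset.Properties
open import Data.Vec using ([]; _∷_; lookup; here; there)
open import Data.Vec.Properties using ([]=⇒lookup; lookup⇒[]=; ≡-dec)
open import Data.List using (List; []; _∷_; length; filter; foldr; _++_)
import Data.List.Properties as List
import Data.List.Relation.Unary.All.Properties as All
import Data.List.Membership.Propositional as LM
open LM using () renaming (_∈_ to _∈ₗ_)
open import Data.List.Membership.Propositional.Properties using (∈-filter⁺; ∈-filter⁻)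
open import Data.List.Relation.Unary.All as All using (All; []; _∷_)
open import Data.List.Relation.Unary.Any as Any using (Any; here; there)
open import Data.List.Relation.Unary.AllPairs using ([]; _∷_)
open import Data.List.Relation.Unary.Unique.Propositional using (Unique)
import Data.List.Relation.Unary.Unique.Propositional.Properties as Unique
open import Data.Product using (Σ; ∃; _×_; _,_; proj₁; proj₂; map₂)
open import Data.Sum using (_⊎_; inj₁; inj₂; [_,_]′)
open import Data.Empty as Empty using (⊥-elim)
open import Function using (_∘_; id; mk⇔; Equivalence)
open import Relation.Nullary
open import Relation.Nullary.Decidable using (¬?; _×-dec_; _→-dec_; map′; decidable-stable)
open import Relation.Binary.PropositionalEquality

private variable
  n : ℕ

_≟ₛ_ : (p q : Subset n) → Dec (p ≡ q)
_≟ₛ_ = ≡-dec Bool._≟_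

-- Sums over subsets

S : Subset n → (Fin n → ℕ) → ℕ
S []            f = 0
S (inside  ∷ p) f = f zero + S p (f ∘ suc)
S (outside ∷ p) f = S p (f ∘ suc)

S-mono : (p : Subset n) {f g : Fin n → ℕ} → (∀ {x} → x ∈ p → f x ≤ g x) → S p f ≤ S p g
S-mono []            f≤g = z≤n
S-mono (inside  ∷ p) f≤g = +-mono-≤ (f≤g here) (S-mono p (f≤g ∘ there))
S-mono (outside ∷ p) f≤g = S-mono p (f≤g ∘ there)

S-cong : (p : Subset n) {f g : Fin n → ℕ} → (∀ x → f x ≡ g x) → S p f ≡ S p g
S-cong p f≡g = ≤-antisym (S-mono p (λ _ → ≤-reflexive (f≡g _))) (S-mono p (λ _ → ≤-reflexive (sym (f≡g _))))

S-const : (p : Subset n) (c : ℕ) → S p (λ _ → c) ≡ ∣ p ∣ * c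
S-const []            c = refl
S-const (inside  ∷ p) c = cong (c +_) (S-const p c)
S-const (outside ∷ p) c = S-const p c

S-bound : (p : Subset n) {f : Fin n → ℕ} (c : ℕ) → (∀ {x} → x ∈ p → f x ≤ c) → S p f ≤ ∣ p ∣ * c
S-bound p c f≤c = ≤-trans (S-mono p f≤c) (≤-reflexive (S-const p c))

S-+ : (p : Subset n) (f g : Fin n → ℕ) → S p (λ x → f x + g x) ≡ S p f + S p g
S-+ []            f g = refl
S-+ (inside  ∷ p) f g = trans (cong (f zero + g zero +_) (S-+ p _ _)) (interchange (f zero) _ _ _)
  where
  interchange : ∀ a b c d → (a + b) + (c + d) ≡ (a + c) + (b + d)
  interchange = solve-∀
S-+ (outside ∷ p) f g = S-+ p _ _

S-* : (p : Subset n) (c : ℕ) (f : Fin n → ℕ) → S p (λ x → c * f x) ≡ c * S p f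
S-* []            c f = sym (*-zeroʳ c)
S-* (inside  ∷ p) c f = trans (cong (c * f zero +_) (S-* p c _)) (sym (*-distribˡ-+ c _ _))
S-* (outside ∷ p) c f = S-* p c _

S-⊆ : (p q : Subset n) (f : Fin n → ℕ) → S (p ∩ q) f ≤ S q f
S-⊆ []            []            f = z≤n
S-⊆ (inside  ∷ p) (inside  ∷ q) f = +-monoʳ-≤ (f zero) (S-⊆ p q _)
S-⊆ (inside  ∷ p) (outside ∷ q) f = S-⊆ p q _
S-⊆ (outside ∷ p) (inside  ∷ q) f = ≤-trans (S-⊆ p q _) (m≤n+m _ (f zero))
S-⊆ (outside ∷ p) (outside ∷ q) f = S-⊆ p q _

S-─⊥ : (p : Subset n) (f : Fin n → ℕ) → S (p ─ ⊥) f ≡ S p f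
S-─⊥ p f = cong (λ r → S r f) (p─⊥≡p p)

S-split : {p : Subset n} {x : Fin n} (f : Fin n → ℕ) → x ∈ p → S p f ≡ f x + S (p - x) f
S-split {p = inside  ∷ p} {zero}  f here        = cong (f zero +_) (sym (S-─⊥ p _))
S-split {p = inside  ∷ p} {suc x} f (there x∈p) =
  trans (cong (f zero +_) (S-split (f ∘ suc) x∈p)) (swap (f zero) (f (suc x)) _)
  where
  swap : ∀ a b c → a + (b + c) ≡ b + (a + c)
  swap = solve-∀
S-split {p = outside ∷ p} {suc x} f (there x∈p) = S-split (f ∘ suc) x∈p

-- Cardinalities

∣p∣≡suc∣p-x∣ : {p : Subset n} {x : Fin n} → x ∈ p → ∣ p ∣ ≡ suc ∣ p - x ∣
∣p∣≡suc∣p-x∣ {p = inside  ∷ p} here        = cong (suc ∘ ∣_∣) (sym (p─⊥≡p p))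
∣p∣≡suc∣p-x∣ {p = inside  ∷ p} (there x∈p) = cong suc (∣p∣≡suc∣p-x∣ x∈p)
∣p∣≡suc∣p-x∣ {p = outside ∷ p} (there x∈p) = ∣p∣≡suc∣p-x∣ x∈p

x∈p-y⇒x≢y : {p : Subset n} {x y : Fin n} → x ∈ p - y → x ≢ y
x∈p-y⇒x≢y {p = inside  ∷ p} {zero} {zero} () refl
x∈p-y⇒x≢y {p = outside ∷ p} {zero} {zero} () refl
x∈p-y⇒x≢y {p = _ ∷ p} {suc x} {suc x} (there i) refl = x∈p-y⇒x≢y i refl

x∈p─q⇒x∉q : (p q : Subset n) {x : Fin n} → x ∈ p ─ q → x ∉ q
x∈p─q⇒x∉q (_ ∷ p) (_ ∷ q) (there i) (there j) = x∈p─q⇒x∉q p q i j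
x∈p─q⇒x∉q (inside  ∷ p) (inside ∷ q) () here
x∈p─q⇒x∉q (outside ∷ p) (inside ∷ q) () here

∣p∩q∣+∣q─p∣≡∣q∣ : (p q : Subset n) → ∣ p ∩ q ∣ + ∣ q ─ p ∣ ≡ ∣ q ∣
∣p∩q∣+∣q─p∣≡∣q∣ []            []            = refl
∣p∩q∣+∣q─p∣≡∣q∣ (inside  ∷ p) (inside  ∷ q) = cong suc (∣p∩q∣+∣q─p∣≡∣q∣ p q)
∣p∩q∣+∣q─p∣≡∣q∣ (inside  ∷ p) (outside ∷ q) = ∣p∩q∣+∣q─p∣≡∣q∣ p q
∣p∩q∣+∣q─p∣≡∣q∣ (outside ∷ p) (inside  ∷ q) = trans (+-suc _ _) (cong suc (∣p∩q∣+∣q─p∣≡∣q∣ p q))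
∣p∩q∣+∣q─p∣≡∣q∣ (outside ∷ p) (outside ∷ q) = ∣p∩q∣+∣q─p∣≡∣q∣ p q

∣p∪q∣≤∣q∣+∣p─q∣ : (p q : Subset n) → ∣ p ∪ q ∣ ≤ ∣ q ∣ + ∣ p ─ q ∣
∣p∪q∣≤∣q∣+∣p─q∣ []            []            = z≤n
∣p∪q∣≤∣q∣+∣p─q∣ (inside  ∷ p) (inside  ∷ q) = s≤s (∣p∪q∣≤∣q∣+∣p─q∣ p q)
∣p∪q∣≤∣q∣+∣p─q∣ (inside  ∷ p) (outside ∷ q) =
  ≤-trans (s≤s (∣p∪q∣≤∣q∣+∣p─q∣ p q)) (≤-reflexive (sym (+-suc _ _)))
∣p∪q∣≤∣q∣+∣p─q∣ (outside ∷ p) (inside  ∷ q) = s≤s (∣p∪q∣≤∣q∣+∣p─q∣ p q)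
∣p∪q∣≤∣q∣+∣p─q∣ (outside ∷ p) (outside ∷ q) = ∣p∪q∣≤∣q∣+∣p─q∣ p q

∣p─q∪q─p∣ : (p q : Subset n) → ∣ (p ─ q) ∪ (q ─ p) ∣ ≡ ∣ p ─ q ∣ + ∣ q ─ p ∣
∣p─q∪q─p∣ []            []            = refl
∣p─q∪q─p∣ (inside  ∷ p) (inside  ∷ q) = ∣p─q∪q─p∣ p q
∣p─q∪q─p∣ (inside  ∷ p) (outside ∷ q) = cong suc (∣p─q∪q─p∣ p q)
∣p─q∪q─p∣ (outside ∷ p) (inside  ∷ q) = trans (cong suc (∣p─q∪q─p∣ p q)) (sym (+-suc _ _))
∣p─q∪q─p∣ (outside ∷ p) (outside ∷ q) = ∣p─q∪q─p∣ p q

-- Two hyperedges that each miss few vertices of `p` must share many of them; later this yields two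
-- common vertices.
∣p∣≤∣p─q∣+∣p─r∣+∣p∩q∩r∣ : (p q r : Subset n) →
  ∣ p ∣ ≤ ∣ p ─ q ∣ + ∣ p ─ r ∣ + ∣ p ∩ q ∩ r ∣
∣p∣≤∣p─q∣+∣p─r∣+∣p∩q∩r∣ p q r = begin
  ∣ p ∣                                         ≤⟨ p⊆q⇒∣p∣≤∣q∣ cover ⟩
  ∣ (p ─ q) ∪ (p ─ r) ∪ (p ∩ q ∩ r) ∣           ≤⟨ ∣∪∣≤ (p ─ q) _ ⟩
  ∣ p ─ q ∣ + ∣ (p ─ r) ∪ (p ∩ q ∩ r) ∣         ≤⟨ +-monoʳ-≤ ∣ p ─ q ∣ (∣∪∣≤ (p ─ r) _) ⟩
  ∣ p ─ q ∣ + (∣ p ─ r ∣ + ∣ p ∩ q ∩ r ∣)       ≡⟨ +-assoc ∣ p ─ q ∣ _ _ ⟨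
  ∣ p ─ q ∣ + ∣ p ─ r ∣ + ∣ p ∩ q ∩ r ∣         ∎
  where
  open ≤-Reasoning
  ∣∪∣≤ : (s t : Subset _) → ∣ s ∪ t ∣ ≤ ∣ s ∣ + ∣ t ∣
  ∣∪∣≤ s t = begin
    ∣ s ∪ t ∣         ≤⟨ ∣p∪q∣≤∣q∣+∣p─q∣ s t ⟩
    ∣ t ∣ + ∣ s ─ t ∣ ≤⟨ +-monoʳ-≤ ∣ t ∣ (∣p─q∣≤∣p∣ s t) ⟩
    ∣ t ∣ + ∣ s ∣     ≡⟨ +-comm ∣ t ∣ _ ⟩
    ∣ s ∣ + ∣ t ∣     ∎
  cover : p ⊆ (p ─ q) ∪ (p ─ r) ∪ (p ∩ q ∩ r)
  cover {x} x∈p with x ∈? q | x ∈? r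
  ... | no x∉q  | _       = x∈p∪q⁺ (inj₁ (x∈p∧x∉q⇒x∈p─q x∈p x∉q))
  ... | yes _   | no x∉r  = x∈p∪q⁺ (inj₂ (x∈p∪q⁺ (inj₁ (x∈p∧x∉q⇒x∈p─q x∈p x∉r))))
  ... | yes x∈q | yes x∈r = x∈p∪q⁺ (inj₂ (x∈p∪q⁺ (inj₂ (x∈p∩q⁺ (x∈p , x∈p∩q⁺ (x∈q , x∈r))))))

1≤∣p∣⇒∃ : (p : Subset n) → 1 ≤ ∣ p ∣ → ∃ λ x → x ∈ p
1≤∣p∣⇒∃ (inside  ∷ p) _   = zero , here
1≤∣p∣⇒∃ (outside ∷ p) 1≤p with x , x∈p ← 1≤∣p∣⇒∃ p 1≤p = suc x , there x∈p

x∈p⇒1≤∣p∣ : {p : Subset n} {x : Fin n} → x ∈ p → 1 ≤ ∣ p ∣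
x∈p⇒1≤∣p∣ x∈p = subst (1 ≤_) (sym (∣p∣≡suc∣p-x∣ x∈p)) (s≤s z≤n)

two-elements : (p : Subset n) → 2 ≤ ∣ p ∣ → ∃ λ x → ∃ λ y → x ∈ p × y ∈ p × y ≢ x
two-elements p 2≤p with 1≤∣p∣⇒∃ p (≤-trans (s≤s z≤n) 2≤p)
... | x , x∈p with 1≤∣p∣⇒∃ (p - x) (s≤s⁻¹ (subst (2 ≤_) (∣p∣≡suc∣p-x∣ x∈p) 2≤p))
...   | y , y∈ = x , y , x∈p , p─q⊆p p _ y∈ , x∈p-y⇒x≢y {p = p} y∈

2≤∣p∣ : {p : Subset n} {x y : Fin n} → x ∈ p → y ∈ p → y ≢ x → 2 ≤ ∣ p ∣
2≤∣p∣ x∈p y∈p y≢x =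
  subst (2 ≤_) (sym (∣p∣≡suc∣p-x∣ x∈p)) (s≤s (x∈p⇒1≤∣p∣ (x∈p∧x≢y⇒x∈p-y y∈p y≢x)))

3≤∣p∣ : {p : Subset n} {x y z : Fin n} → x ∈ p → y ∈ p → z ∈ p → y ≢ x → z ≢ x → z ≢ y → 3 ≤ ∣ p ∣
3≤∣p∣ x∈p y∈p z∈p y≢x z≢x z≢y =
  subst (3 ≤_) (sym (∣p∣≡suc∣p-x∣ x∈p))
    (s≤s (2≤∣p∣ (x∈p∧x≢y⇒x∈p-y y∈p y≢x) (x∈p∧x≢y⇒x∈p-y z∈p z≢x) z≢y))

⊆∧∣∣⇒≡ : {p q : Subset n} → p ⊆ q → ∣ p ∣ ≡ ∣ q ∣ → p ≡ q
⊆∧∣∣⇒≡ {p = p} {q} p⊆q ∣p∣≡∣q∣ = ⊆-antisym p⊆q λ {x} x∈q → decidable-stable (x ∈? p) λ x∉p →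
  <⇒≢ (p⊂q⇒∣p∣<∣q∣ (p⊆q , x , x∈q , x∉p)) ∣p∣≡∣q∣

≢⇒∃∉ : {p q : Subset n} → p ≢ q → ∣ p ∣ ≡ ∣ q ∣ → ∃ λ x → x ∈ p × x ∉ q
≢⇒∃∉ {p = p} {q} p≢q ∣p∣≡∣q∣ with Fin.any? (λ x → x ∈? p ×-dec ¬? (x ∈? q))
... | yes w = w
... | no ¬w = ⊥-elim (p≢q (⊆∧∣∣⇒≡ (λ {x} x∈p → decidable-stable (x ∈? q) λ x∉q → ¬w (x , x∈p , x∉q)) ∣p∣≡∣q∣))

-- Weighted degrees in a list of subsets

∑ : {A : Set} → List A → (A → ℕ) → ℕ
∑ []       f = 0
∑ (a ∷ as) f = f a + ∑ as f

∑-bound : {A : Set} (as : List A) {f : A → ℕ} (c : ℕ) → (∀ {a} → a ∈ₗ as → f a ≤ c) → ∑ as f ≤ length as * c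
∑-bound []       c f≤c = z≤n
∑-bound (a ∷ as) c f≤c = +-mono-≤ (f≤c (here refl)) (∑-bound as c (f≤c ∘ there))

∑-cong : {A : Set} (as : List A) {f g : A → ℕ} → (∀ a → f a ≡ g a) → ∑ as f ≡ ∑ as g
∑-cong []       f≡g = refl
∑-cong (a ∷ as) f≡g = cong₂ _+_ (f≡g a) (∑-cong as f≡g)

𝟙 : Subset n → Fin n → ℕ
𝟙 p x = if lookup p x then 1 else 0

∈⇒𝟙 : {p : Subset n} {x : Fin n} → x ∈ p → 𝟙 p x ≡ 1
∈⇒𝟙 x∈p rewrite []=⇒lookup x∈p = refl

-- Weight 1 gives the degree, and weight |X ∩ g| - 1 counts the pairs of X at a vertex with
-- multiplicity, so one double count serves both.
wdeg : (Subset n → ℕ) → List (Subset n) → Fin n → ℕ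
wdeg w L x = ∑ L λ g → 𝟙 g x * w g

S-𝟙 : (X g : Subset n) (f : Fin n → ℕ) → S X (λ x → 𝟙 g x * f x) ≡ S (X ∩ g) f
S-𝟙 []            []            f = refl
S-𝟙 (inside  ∷ X) (inside  ∷ g) f = cong₂ _+_ (*-identityˡ (f zero)) (S-𝟙 X g _)
S-𝟙 (inside  ∷ X) (outside ∷ g) f = S-𝟙 X g _
S-𝟙 (outside ∷ X) (_       ∷ g) f = S-𝟙 X g _

S-0 : (X : Subset n) → S X (λ _ → 0) ≡ 0
S-0 X = trans (S-const X 0) (*-zeroʳ ∣ X ∣)

-- Double counting of the incidences between `X` and `L`.
S-wdeg : (w : Subset n → ℕ) (L : List (Subset n)) (X : Subset n) (f : Fin n → ℕ) →
  S X (λ x → wdeg w L x * f x) ≡ ∑ L (λ g → w g * S (X ∩ g) f)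
S-wdeg w []      X f = S-0 X
S-wdeg w (g ∷ L) X f = begin
  S X (λ x → (𝟙 g x * w g + wdeg w L x) * f x)
    ≡⟨ S-cong X (λ x → distr (𝟙 g x) (w g) (wdeg w L x) (f x)) ⟩
  S X (λ x → w g * (𝟙 g x * f x) + wdeg w L x * f x)
    ≡⟨ S-+ X _ _ ⟩
  S X (λ x → w g * (𝟙 g x * f x)) + S X (λ x → wdeg w L x * f x)
    ≡⟨ cong₂ _+_ (trans (S-* X (w g) _) (cong (w g *_) (S-𝟙 X g f))) (S-wdeg w L X f) ⟩
  w g * S (X ∩ g) f + ∑ L (λ g → w g * S (X ∩ g) f) ∎
  where
  open ≡-Reasoning
  distr : ∀ a b c d → (a * b + c) * d ≡ b * (a * d) + c * d
  distr = solve-∀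

deg : List (Subset n) → Fin n → ℕ
deg = wdeg (λ _ → 1)

1≤deg : {L : List (Subset n)} {x : Fin n} {g : Subset n} → g ∈ₗ L → x ∈ g → 1 ≤ deg L x
1≤deg {L = g ∷ L} {x} (here refl) x∈g rewrite ∈⇒𝟙 x∈g = s≤s z≤n
1≤deg {L = h ∷ L} {x} (there g∈L) x∈g = ≤-trans (1≤deg g∈L x∈g) (m≤n+m _ (𝟙 h x * 1))

2≤deg : {L : List (Subset n)} {x : Fin n} {g h : Subset n} →
  g ∈ₗ L → x ∈ g → h ∈ₗ L → x ∈ h → g ≢ h → 2 ≤ deg L x
2≤deg {L = g ∷ L} (here refl) x∈g (here refl) x∈h g≢h = ⊥-elim (g≢h refl)
2≤deg {L = g ∷ L} {x} (here refl) x∈g (there h∈L) x∈h g≢h rewrite ∈⇒𝟙 x∈g = s≤s (1≤deg h∈L x∈h)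
2≤deg {L = h ∷ L} {x} (there g∈L) x∈g (here refl) x∈h g≢h rewrite ∈⇒𝟙 x∈h = s≤s (1≤deg g∈L x∈g)
2≤deg {L = k ∷ L} {x} (there g∈L) x∈g (there h∈L) x∈h g≢h =
  ≤-trans (2≤deg g∈L x∈g h∈L x∈h g≢h) (m≤n+m _ (𝟙 k x * 1))

deg≤1⇒≡ : {L : List (Subset n)} {x : Fin n} → deg L x ≤ 1 →
  {g h : Subset n} → g ∈ₗ L → x ∈ g → h ∈ₗ L → x ∈ h → g ≡ h
deg≤1⇒≡ deg≤1 {g} {h} g∈L x∈g h∈L x∈h with g ≟ₛ h
... | yes g≡h = g≡h
... | no  g≢h = ⊥-elim (<⇒≱ (2≤deg g∈L x∈g h∈L x∈h g≢h) deg≤1)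

1≤deg⇒∃ : (L : List (Subset n)) {x : Fin n} → 1 ≤ deg L x → ∃ λ g → g ∈ₗ L × x ∈ g
1≤deg⇒∃ (g ∷ L) {x} 1≤ with x ∈? g
... | yes x∈g = g , here refl , x∈g
... | no x∉g with lookup g x in eq
...   | true  = ⊥-elim (x∉g (lookup⇒[]= x g eq))
...   | false with h , h∈L , x∈h ← 1≤deg⇒∃ L 1≤ = h , there h∈L , x∈h

2≤deg⇒∃ : {L : List (Subset n)} → Unique L → {x : Fin n} → 2 ≤ deg L x →
  ∃ λ g → ∃ λ h → g ∈ₗ L × x ∈ g × h ∈ₗ L × x ∈ h × g ≢ h
2≤deg⇒∃ {L = g ∷ L} (g∉L ∷ uL) {x} 2≤ with lookup g x in eq
... | true with h , h∈L , x∈h ← 1≤deg⇒∃ L (s≤s⁻¹ 2≤) =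
  g , h , here refl , lookup⇒[]= x g eq , there h∈L , x∈h , All.lookup g∉L h∈L
... | false with a , b , a∈ , xa , b∈ , xb , a≢b ← 2≤deg⇒∃ uL 2≤ =
  a , b , there a∈ , xa , there b∈ , xb , a≢b

-- Demands and shares of a vertex

-- With d = 3 + m: N = 2d - 1 and M = 2d² - 5d + 5 = (d - 2)(2d - 1) + 3, so the
-- claim is m(h) ≥ N / M.
N M : ℕ → ℕ
N m = 5 + 2 * m
M m = suc m * N m + 3

-- 12 D is split evenly among the t edges at a vertex, where D is the part of its
-- demand 2 N left over by q; the multiplier is 12 / t, rounded up to 3 once t ≥ 4.
multiplier : ℕ → ℕ
multiplier 0 = 12
multiplier 1 = 12
multiplier 2 = 6
multiplier 3 = 4
multiplier _ = 3

share : (m t q : ℕ) → ℕ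
share m t q = multiplier t * (2 * N m ∸ 3 * q)

multiplier≤12 : ∀ t → multiplier t ≤ 12
multiplier≤12 0 = ≤-refl
multiplier≤12 1 = ≤-refl
multiplier≤12 2 = m≤m+n 6 6
multiplier≤12 3 = m≤m+n 4 8
multiplier≤12 (suc (suc (suc (suc _)))) = m≤m+n 3 9

multiplier≤6 : ∀ {t} → 2 ≤ t → multiplier t ≤ 6
multiplier≤6 {2} _ = ≤-refl
multiplier≤6 {3} _ = m≤m+n 4 2
multiplier≤6 {suc (suc (suc (suc _)))} _ = m≤m+n 3 3
multiplier≤6 {1} (s≤s ())

multiplier≤4 : ∀ {t} → 3 ≤ t → multiplier t ≤ 4
multiplier≤4 {3} _ = ≤-refl
multiplier≤4 {suc (suc (suc (suc _)))} _ = m≤m+n 3 1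
multiplier≤4 {1} (s≤s ())
multiplier≤4 {2} (s≤s (s≤s ()))

multiplier≤3 : ∀ {t} → 4 ≤ t → multiplier t ≤ 3
multiplier≤3 {suc (suc (suc (suc _)))} _ = ≤-refl
multiplier≤3 {1} (s≤s ())
multiplier≤3 {2} (s≤s (s≤s ()))
multiplier≤3 {3} (s≤s (s≤s (s≤s ())))

12≤t*multiplier : ∀ {t} → 1 ≤ t → 12 ≤ t * multiplier t
12≤t*multiplier {1} _ = ≤-refl
12≤t*multiplier {2} _ = ≤-refl
12≤t*multiplier {3} _ = ≤-refl
12≤t*multiplier {suc (suc (suc (suc t)))} _ = m≤m+n 12 (t * 3)

share-bound : ∀ m {t q} q₀ k v → multiplier t ≤ v → q₀ ≤ q → 2 * N m ≡ 3 * q₀ + k → share m t q ≤ v * k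
share-bound m {t} {q} q₀ k v t≤v q₀≤q eq = *-mono-≤ t≤v (m≤n+o⇒m∸n≤o _ (3 * q) (begin
  2 * N m    ≡⟨ eq ⟩
  3 * q₀ + k ≤⟨ +-monoˡ-≤ k (*-monoʳ-≤ 3 q₀≤q) ⟩
  3 * q + k  ∎))
  where open ≤-Reasoning

≤-from-≡ : ∀ {a b} c → b ≡ a + c → a ≤ b
≤-from-≡ {a} c eq = ≤-trans (m≤m+n a c) (≤-reflexive (sym eq))

-- For a vertex whose d - 1 pairs inside one hyperedge are all covered by shared hyperedges: 2(2d -
-- 1) - 3(d - 1) = d + 1 remains. It may lie in a single member of A and B, hence the factor 12.
share-full : ∀ m {t q} → 2 + m ≤ q → share m t q ≤ 12 * (4 + m)
share-full m {t} le = share-bound m (2 + m) (4 + m) 12 (multiplier≤12 t) le (eq m)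
  where
  eq : ∀ m → 2 * (5 + 2 * m) ≡ 3 * (2 + m) + (4 + m)
  eq = solve-∀

-- Serves mainly a vertex in exactly one member of A and a different one of B, where at least two
-- pairs fall to the shared hyperedges.
share-q≥2 : ∀ m {t q} → 2 ≤ t → 2 ≤ q → share m t q ≤ 24 * (1 + m)
share-q≥2 m {t} {q} 2≤t 2≤q =
  ≤-trans (share-bound m {q = q} 2 (4 + 4 * m) 6 (multiplier≤6 2≤t) 2≤q (eq m)) (≤-reflexive (eq′ m))
  where
  eq : ∀ m → 2 * (5 + 2 * m) ≡ 3 * 2 + (4 + 4 * m)
  eq = solve-∀
  eq′ : ∀ m → 6 * (4 + 4 * m) ≡ 24 * (1 + m)
  eq′ = solve-∀

share-t≡3 : ∀ m {t q} → 3 ≤ t → 1 ≤ q → share m t q ≤ 16 * m + 28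
share-t≡3 m {t} {q} 3≤t 1≤q =
  ≤-trans (share-bound m {q = q} 1 (7 + 4 * m) 4 (multiplier≤4 3≤t) 1≤q (eq m)) (≤-reflexive (eq′ m))
  where
  eq : ∀ m → 2 * (5 + 2 * m) ≡ 3 * 1 + (7 + 4 * m)
  eq = solve-∀
  eq′ : ∀ m → 4 * (7 + 4 * m) ≡ 16 * m + 28
  eq′ = solve-∀

share-t≥4 : ∀ m {t q} → 4 ≤ t → share m t q ≤ 12 * m + 30
share-t≥4 m {t} {q} 4≤t =
  ≤-trans (share-bound m {q = q} 0 (2 * N m) 3 (multiplier≤3 4≤t) z≤n refl) (≤-reflexive (eq′ m))
  where
  eq′ : ∀ m → 3 * (2 * (5 + 2 * m)) ≡ 12 * m + 30
  eq′ = solve-∀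

2≤∧≢2⇒3≤ : ∀ {t} → 2 ≤ t → t ≢ 2 → 3 ≤ t
2≤∧≢2⇒3≤ 2≤t t≢2 = ≤∧≢⇒< 2≤t (t≢2 ∘ sym)

3≤-cases : ∀ {t} → 3 ≤ t → t ≡ 3 ⊎ 4 ≤ t
3≤-cases {t} 3≤t with m≤n⇒m<n∨m≡n 3≤t
... | inj₁ 4≤t = inj₂ 4≤t
... | inj₂ eq  = inj₁ (sym eq)

share-t≥3 : ∀ m {t q} → 3 ≤ t → (t ≡ 3 → 1 ≤ q) → share m t q ≤ 16 * m + 30
share-t≥3 m {q = q} 3≤t 1≤q with 3≤-cases 3≤t
... | inj₁ t≡3 = ≤-trans (share-t≡3 m 3≤t (1≤q t≡3)) (+-monoʳ-≤ (16 * m) (m≤m+n 28 2))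
... | inj₂ 4≤t = ≤-trans (share-t≥4 m {q = q} 4≤t) (+-monoˡ-≤ 30 (*-monoˡ-≤ m (m≤m+n 12 4)))

-- From m = 1 on the case t = 3 dominates, as 12m + 30 ≤ 16m + 28; at m = 0 this fails by 2.
share-t≥3′ : ∀ m {t q} → 1 ≤ m → 3 ≤ t → (t ≡ 3 → 1 ≤ q) → share m t q ≤ 16 * m + 28
share-t≥3′ m@(suc k) {q = q} _ 3≤t 1≤q with 3≤-cases 3≤t
... | inj₁ t≡3 = share-t≡3 m 3≤t (1≤q t≡3)
... | inj₂ 4≤t = ≤-trans (share-t≥4 m {q = q} 4≤t) (≤-from-≡ (4 * k + 2) (eq k))
  where
  eq : ∀ k → 16 * suc k + 28 ≡ (12 * suc k + 30) + (4 * k + 2)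
  eq = solve-∀

-- Local structure of two preimages at a vertex

-- A and B are the hyperedges of two preimages inside a vertex set; Blue is
-- adjacency through the remaining hyperedges, which the preimages share.
record Configuration (m : ℕ) {n : ℕ} (q : Fin n → ℕ) (Blue : Fin n → Fin n → Set)
                     (A B : List (Subset n)) : Set where
  field
    blue?    : ∀ x y → Dec (Blue x y)
    blue-sym : ∀ {x y} → Blue x y → Blue y x
    -- In the intended instance `q` counts pairs with multiplicity over the shared hyperedges, so it
    -- only bounds the number of blue neighbours from above.
    blue≤q   : ∀ x (Y : Subset n) → (∀ {y} → y ∈ Y → y ≢ x × Blue x y) → ∣ Y ∣ ≤ q x
    uniqueᴬ  : Unique A
    uniqueᴮ  : Unique B
    sizeᴬ    : ∀ {g} → g ∈ₗ A → ∣ g ∣ ≡ 3 + m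
    sizeᴮ    : ∀ {g} → g ∈ₗ B → ∣ g ∣ ≡ 3 + m
    coverᴬ   : ∀ {g x y} → g ∈ₗ A → x ∈ g → y ∈ g → y ≢ x → Blue x y ⊎ ∃ λ b → b ∈ₗ B × x ∈ b × y ∈ b
    coverᴮ   : ∀ {g x y} → g ∈ₗ B → x ∈ g → y ∈ g → y ≢ x → Blue x y ⊎ ∃ λ a → a ∈ₗ A × x ∈ a × y ∈ a
    privateᴬ : ∀ {e} → e ∈ₗ A → ∃ λ x → ∃ λ y → x ∈ e × y ∈ e × y ≢ x × ¬ Blue x y ×
               (∀ {g} → g ∈ₗ A → x ∈ g → y ∈ g → g ≡ e)
    privateᴮ : ∀ {e} → e ∈ₗ B → ∃ λ x → ∃ λ y → x ∈ e × y ∈ e × y ≢ x × ¬ Blue x y ×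
               (∀ {g} → g ∈ₗ B → x ∈ g → y ∈ g → g ≡ e)
    -- Each vertex of X lies in a hyperedge belonging to only one preimage; such a hyperedge differs
    -- from every common one.
    other    : ∀ {e x} → e ∈ₗ A → e ∈ₗ B → x ∈ e → ∃ λ g → x ∈ g × g ≢ e × (g ∈ₗ A ⊎ g ∈ₗ B)

-- By this symmetry bounds are proved for members of `A` only and transferred to `B`.
swap-configuration : ∀ {m q Blue} {A B : List (Subset n)} →
  Configuration m q Blue A B → Configuration m q Blue B A
swap-configuration C = record
  { blue? = blue? ; blue-sym = blue-sym ; blue≤q = blue≤q
  ; uniqueᴬ = uniqueᴮ ; uniqueᴮ = uniqueᴬ ; sizeᴬ = sizeᴮ ; sizeᴮ = sizeᴬ
  ; coverᴬ = coverᴮ ; coverᴮ = coverᴬ ; privateᴬ = privateᴮ ; privateᴮ = privateᴬ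
  ; other = λ e∈B e∈A x∈e → map₂ (λ { (x∈g , g≢e , s) → x∈g , g≢e , [ inj₂ , inj₁ ]′ s }) (other e∈A e∈B x∈e)
  }
  where open Configuration C

module VertexTypes {m : ℕ} {q : Fin n → ℕ} {Blue : Fin n → Fin n → Set} {A B : List (Subset n)}
                   (C : Configuration m q Blue A B) where
  open Configuration C

  -- A hyperedge lying in both `A` and `B` counts twice, once for each preimage.
  t : Fin n → ℕ
  t x = deg A x + deg B x

  Full : Subset n → Fin n → Set
  Full e x = ∀ {y} → y ∈ e → y ≢ x → Blue x y

  NonFull : Subset n → Fin n → Set
  NonFull e x = ∃ λ y → y ∈ e × y ≢ x × ¬ Blue x y

  full? : ∀ e x → Full e x ⊎ NonFull e x
  full? e x with Fin.any? (λ y → y ∈? e ×-dec ¬? (y Fin.≟ x) ×-dec ¬? (blue? x y))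
  ... | yes w = inj₂ w
  ... | no ¬w = inj₁ λ {y} y∈e y≢x → decidable-stable (blue? x y) λ ¬xy → ¬w (y , y∈e , y≢x , ¬xy)

  full⇒q : ∀ {e x} → e ∈ₗ A → x ∈ e → Full e x → 2 + m ≤ q x
  full⇒q {e} {x} e∈A x∈e full = subst (_≤ q x)
    (suc-injective (trans (sym (∣p∣≡suc∣p-x∣ x∈e)) (sizeᴬ e∈A)))
    (blue≤q x (e - x) λ y∈ → let y≢x = x∈p-y⇒x≢y {p = e} y∈ in y≢x , full (p─q⊆p e _ y∈) y≢x)

  blue⇒1≤q : ∀ {x y} → y ≢ x → Blue x y → 1 ≤ q x
  blue⇒1≤q {x} {y} y≢x xy = subst (_≤ q x) (∣⁅x⁆∣≡1 y)
    (blue≤q x ⁅ y ⁆ λ z∈ → subst (λ z → z ≢ x × Blue x z) (sym (x∈⁅y⁆⇒x≡y y z∈)) (y≢x , xy))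

  blue⇒2≤q : ∀ {x y z} → y ≢ x → Blue x y → z ≢ x → Blue x z → z ≢ y → 2 ≤ q x
  blue⇒2≤q {x} {y} {z} y≢x xy z≢x xz z≢y = ≤-trans
    (2≤∣p∣ (x∈p∪q⁺ (inj₁ (x∈⁅x⁆ y))) (x∈p∪q⁺ {q = ⁅ z ⁆} (inj₂ (x∈⁅x⁆ z))) z≢y)
    (blue≤q x (⁅ y ⁆ ∪ ⁅ z ⁆) λ {w} w∈ → [ (λ w∈ → subst (λ z → z ≢ x × Blue x z) (sym (x∈⁅y⁆⇒x≡y y w∈)) (y≢x , xy))
                                         , (λ w∈ → subst (λ z → z ≢ x × Blue x z) (sym (x∈⁅y⁆⇒x≡y z w∈)) (z≢x , xz))
                                         ]′ (x∈p∪q⁻ ⁅ y ⁆ ⁅ z ⁆ w∈))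

  nonFull⇒cover : ∀ {e x} → e ∈ₗ A → x ∈ e → ((y , _) : NonFull e x) → ∃ λ b → b ∈ₗ B × x ∈ b × y ∈ b
  nonFull⇒cover e∈A x∈e (y , y∈e , y≢x , ¬xy) with coverᴬ e∈A x∈e y∈e y≢x
  ... | inj₁ xy = ⊥-elim (¬xy xy)
  ... | inj₂ w  = w

  nonFull⇒2≤t : ∀ {e x} → e ∈ₗ A → x ∈ e → NonFull e x → 2 ≤ t x
  nonFull⇒2≤t e∈A x∈e nf with b , b∈B , x∈b , _ ← nonFull⇒cover e∈A x∈e nf =
    +-mono-≤ (1≤deg e∈A x∈e) (1≤deg b∈B x∈b)

  -- If `B` had only one hyperedge at `x`, it would have to cover every pair at `x` inside each
  -- member of `A`, as no pair is blue. Equal sizes then make all these members equal to it,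
  -- although two of them are distinct.
  2≤degᴬ⇒2≤degᴮ : ∀ {x} → (∀ {y} → y ≢ x → ¬ Blue x y) → 2 ≤ deg A x → 2 ≤ deg B x
  2≤degᴬ⇒2≤degᴮ {x} ¬blue 2≤ with 2 ≤? deg B x
  ... | yes le = le
  ... | no ¬le with g , h , g∈A , x∈g , h∈A , x∈h , g≢h ← 2≤deg⇒∃ uniqueᴬ 2≤ =
    ⊥-elim (g≢h (trans (proj₂ (proj₂ (proj₂ cg))) (trans
      (deg≤1⇒≡ (≤-pred (≰⇒> ¬le)) (proj₁ (proj₂ cg)) (proj₁ (proj₂ (proj₂ cg))) (proj₁ (proj₂ ch)) (proj₁ (proj₂ (proj₂ ch))))
      (sym (proj₂ (proj₂ (proj₂ ch)))))))
    where
    same : ∀ {g} → g ∈ₗ A → x ∈ g → ∃ λ b → b ∈ₗ B × x ∈ b × g ≡ b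
    same {g} g∈A x∈g with 1≤∣p∣⇒∃ (g - x) (subst (1 ≤_) (suc-injective (trans (sym (sizeᴬ g∈A)) (∣p∣≡suc∣p-x∣ x∈g))) (s≤s z≤n))
    ... | y , y∈ with coverᴬ g∈A x∈g (p─q⊆p g _ y∈) (x∈p-y⇒x≢y {p = g} y∈)
    ...   | inj₁ xy = ⊥-elim (¬blue (x∈p-y⇒x≢y {p = g} y∈) xy)
    ...   | inj₂ (b , b∈B , x∈b , _) = b , b∈B , x∈b , ⊆∧∣∣⇒≡ g⊆b (trans (sizeᴬ g∈A) (sym (sizeᴮ b∈B)))
      where
      g⊆b : g ⊆ b
      g⊆b {z} z∈g with z Fin.≟ x
      ... | yes refl = x∈b
      ... | no z≢x with coverᴬ g∈A x∈g z∈g z≢x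
      ...   | inj₁ xz = ⊥-elim (¬blue z≢x xz)
      ...   | inj₂ (b′ , b′∈B , x∈b′ , z∈b′) = subst (z ∈_) (deg≤1⇒≡ (≤-pred (≰⇒> ¬le)) b′∈B x∈b′ b∈B x∈b) z∈b′
    cg = same g∈A x∈g
    ch = same h∈A x∈h

module LocalBound {m : ℕ} {q : Fin n → ℕ} {Blue : Fin n → Fin n → Set} {A B : List (Subset n)}
                  (C : Configuration m q Blue A B) where
  open Configuration C
  open VertexTypes C

  ω : Fin n → ℕ
  ω x = share m (t x) (q x)

  -- Without blue pairs at `x`, two members of one list at `x` force two of the other, so `t x` is
  -- at most 2 or at least 4.
  t≡3⇒1≤q : ∀ {x} → t x ≡ 3 → 1 ≤ q x
  t≡3⇒1≤q {x} t≡3 with 1 ≤? q x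
  ... | yes le = le
  ... | no ¬le = ⊥-elim (4≰3 (subst (4 ≤_) t≡3 4≤t))
    where
    4≰3 : ¬ 4 ≤ 3
    4≰3 (s≤s (s≤s (s≤s ())))
    3≰2 : ¬ 3 ≤ 2
    3≰2 (s≤s (s≤s ()))
    ¬blue : ∀ {y} → y ≢ x → ¬ Blue x y
    ¬blue y≢x xy = ¬le (blue⇒1≤q y≢x xy)
    4≤t : 4 ≤ t x
    4≤t with 2 ≤? deg A x | 2 ≤? deg B x
    ... | yes a | _     = +-mono-≤ a (2≤degᴬ⇒2≤degᴮ ¬blue a)
    ... | no _  | yes b = +-mono-≤ (VertexTypes.2≤degᴬ⇒2≤degᴮ (swap-configuration C) ¬blue b) b
    ... | no ¬a | no ¬b = ⊥-elim (3≰2 (subst (_≤ 2) t≡3 (+-mono-≤ (≤-pred (≰⇒> ¬a)) (≤-pred (≰⇒> ¬b)))))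

  -- Data of a vertex whose only hyperedges are `e` in `A` and `b` in `B`. Pairs from `x` to the
  -- symmetric difference of `e` and `b` are covered by just one of the two and hence blue. Both
  -- differences have p = |e ─ b| elements, which gives q ≥ 2p.
  record Simple (e : Subset n) (x : Fin n) : Set where
    field
      b      : Subset n
      b∈B    : b ∈ₗ B
      x∈b    : x ∈ b
      only-b : ∀ {b′} → b′ ∈ₗ B → x ∈ b′ → b′ ≡ b
      1≤p    : 1 ≤ ∣ e ─ b ∣
      2p≤q   : ∣ e ─ b ∣ + ∣ e ─ b ∣ ≤ q x
      blue   : ∀ {z} → z ∈ b ─ e → z ≢ x × Blue x z
      1≤∣b─e∣ : 1 ≤ ∣ b ─ e ∣

  simple : ∀ {e x} → e ∈ₗ A → ¬ e ∈ₗ B → x ∈ e → NonFull e x → t x ≡ 2 → Simple e x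
  simple {e} {x} e∈A e∉B x∈e nf t≡2 with b , b∈B , x∈b , _ ← nonFull⇒cover e∈A x∈e nf = record
    { b = b ; b∈B = b∈B ; x∈b = x∈b
    ; only-b = λ b′∈B x∈b′ → deg≤1⇒≡ degᴮ≤1 b′∈B x∈b′ b∈B x∈b
    ; 1≤p = let u , u∈e , u∉b = ≢⇒∃∉ (b≢e ∘ sym) (sym ∣b∣≡∣e∣) in x∈p⇒1≤∣p∣ (x∈p∧x∉q⇒x∈p─q u∈e u∉b)
    ; 2p≤q = subst (_≤ q x) (trans (∣p─q∪q─p∣ e b) (cong (∣ e ─ b ∣ +_) (sym ∣e─b∣≡∣b─e∣)))
        (blue≤q x ((e ─ b) ∪ (b ─ e)) λ z∈ → [ blue₁ , blue₂ ]′ (x∈p∪q⁻ (e ─ b) (b ─ e) z∈))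
    ; blue = blue₂
    ; 1≤∣b─e∣ = let u , u∈b , u∉e = ≢⇒∃∉ b≢e ∣b∣≡∣e∣ in x∈p⇒1≤∣p∣ (x∈p∧x∉q⇒x∈p─q u∈b u∉e)
    }
    where
    degᴬ≤1 : deg A x ≤ 1
    degᴬ≤1 = +-cancelʳ-≤ 1 _ 1 (≤-trans (+-monoʳ-≤ (deg A x) (1≤deg b∈B x∈b)) (≤-reflexive t≡2))
    degᴮ≤1 : deg B x ≤ 1
    degᴮ≤1 = +-cancelˡ-≤ 1 _ 1 (≤-trans (+-monoˡ-≤ (deg B x) (1≤deg e∈A x∈e)) (≤-reflexive t≡2))
    b≢e : b ≢ e
    b≢e refl = e∉B b∈B
    ∣b∣≡∣e∣ : ∣ b ∣ ≡ ∣ e ∣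
    ∣b∣≡∣e∣ = trans (sizeᴮ b∈B) (sym (sizeᴬ e∈A))
    ∣e─b∣≡∣b─e∣ : ∣ e ─ b ∣ ≡ ∣ b ─ e ∣
    ∣e─b∣≡∣b─e∣ = +-cancelˡ-≡ ∣ b ∩ e ∣ _ _ (trans (∣p∩q∣+∣q─p∣≡∣q∣ b e) (trans (sym ∣b∣≡∣e∣)
      (trans (sym (∣p∩q∣+∣q─p∣≡∣q∣ e b)) (cong (λ p → ∣ p ∣ + ∣ b ─ e ∣) (∩-comm e b)))))
    blue₁ : ∀ {z} → z ∈ e ─ b → z ≢ x × Blue x z
    blue₁ {z} z∈ = z≢x , [ id , (λ { (b′ , b′∈B , x∈b′ , z∈b′) → ⊥-elim (z∉b (subst (z ∈_) (deg≤1⇒≡ degᴮ≤1 b′∈B x∈b′ b∈B x∈b) z∈b′)) }) ]′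
                           (coverᴬ e∈A x∈e (p─q⊆p e b z∈) z≢x)
      where
      z∉b = x∈p─q⇒x∉q e b z∈
      z≢x : z ≢ x
      z≢x refl = z∉b x∈b
    blue₂ : ∀ {z} → z ∈ b ─ e → z ≢ x × Blue x z
    blue₂ {z} z∈ = z≢x , [ id , (λ { (a , a∈A , x∈a , z∈a) → ⊥-elim (z∉e (subst (z ∈_) (deg≤1⇒≡ degᴬ≤1 a∈A x∈a e∈A x∈e) z∈a)) }) ]′
                           (coverᴮ b∈B x∈b (p─q⊆p b e z∈) z≢x)
      where
      z∉e = x∈p─q⇒x∉q b e z∈
      z≢x : z ≢ x
      z≢x refl = z∉e x∈e

  simple⇒2≤q : ∀ {e x} → Simple e x → 2 ≤ q x
  simple⇒2≤q s = ≤-trans (+-mono-≤ 1≤p 1≤p) 2p≤q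
    where open Simple s

  -- The hyperedge `e` counts twice and the one supplied by `other` once more.
  common⇒3≤t : ∀ {e x} → e ∈ₗ A → e ∈ₗ B → x ∈ e → 3 ≤ t x
  common⇒3≤t e∈A e∈B x∈e with other e∈A e∈B x∈e
  ... | g , x∈g , g≢e , inj₁ g∈A = +-mono-≤ (2≤deg g∈A x∈g e∈A x∈e g≢e) (1≤deg e∈B x∈e)
  ... | g , x∈g , g≢e , inj₂ g∈B = +-mono-≤ (1≤deg e∈A x∈e) (2≤deg g∈B x∈g e∈B x∈e g≢e)

  3≤t⇒ω : ∀ {x} → 3 ≤ t x → ω x ≤ 16 * m + 30
  3≤t⇒ω 3≤t = share-t≥3 m 3≤t t≡3⇒1≤q

  3≤t⇒ω′ : ∀ {x} → 1 ≤ m → 3 ≤ t x → ω x ≤ 16 * m + 28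
  3≤t⇒ω′ 1≤m 3≤t = share-t≥3′ m 1≤m 3≤t t≡3⇒1≤q

  -- All d vertices have t ≥ 3, and the crude bound on each of them suffices.
  common-bound : ∀ {e} → e ∈ₗ A → e ∈ₗ B → S e ω ≤ 12 * M m
  common-bound {e} e∈A e∈B = begin
    S e ω                    ≤⟨ S-bound e _ (3≤t⇒ω ∘ common⇒3≤t e∈A e∈B) ⟩
    ∣ e ∣ * (16 * m + 30)    ≡⟨ cong (_* (16 * m + 30)) (sizeᴬ e∈A) ⟩
    (3 + m) * (16 * m + 30)  ≤⟨ ≤-from-≡ (6 + 6 * m + 8 * (m * m)) (eq m) ⟩
    12 * M m                 ∎
    where
    open ≤-Reasoning
    eq : ∀ m → 12 * (suc m * (5 + 2 * m) + 3) ≡ (3 + m) * (16 * m + 30) + (6 + 6 * m + 8 * (m * m))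
    eq = solve-∀

  nonFull-type : ∀ {e x} → e ∈ₗ A → ¬ e ∈ₗ B → x ∈ e → NonFull e x → Simple e x ⊎ 3 ≤ t x
  nonFull-type {x = x} e∈A e∉B x∈e nf with t x ≟ 2
  ... | yes t≡2 = inj₁ (simple e∈A e∉B x∈e nf t≡2)
  ... | no  t≢2 = inj₂ (2≤∧≢2⇒3≤ (nonFull⇒2≤t e∈A x∈e nf) t≢2)

  split₂ : ∀ {e x y} → x ∈ e → y ∈ e → y ≢ x → S e ω ≡ ω x + (ω y + S (e - x - y) ω)
  split₂ {x = x} x∈e y∈e y≢x = trans (S-split ω x∈e) (cong (ω x +_) (S-split ω (x∈p∧x≢y⇒x∈p-y y∈e y≢x)))

  ∣e-x-y∣ : ∀ {e x y} → e ∈ₗ A → x ∈ e → y ∈ e → y ≢ x → ∣ e - x - y ∣ ≡ 1 + m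
  ∣e-x-y∣ e∈A x∈e y∈e y≢x = suc-injective (trans (sym (∣p∣≡suc∣p-x∣ (x∈p∧x≢y⇒x∈p-y y∈e y≢x)))
    (suc-injective (trans (sym (∣p∣≡suc∣p-x∣ x∈e)) (sizeᴬ e∈A))))

  ∈-x-y : ∀ (e : Subset n) {x y z} → z ∈ e - x - y → z ∈ e × z ≢ x × z ≢ y
  ∈-x-y e {x} {y} z∈ = let z∈e-x = p─q⊆p (e - x) ⁅ y ⁆ z∈ in
    p─q⊆p e _ z∈e-x , x∈p-y⇒x≢y {p = e} z∈e-x , x∈p-y⇒x≢y {p = e - x} z∈

-- Hyperedges of size 3

module Dimension3 {q : Fin n → ℕ} {Blue : Fin n → Fin n → Set} {A B : List (Subset n)}
                  (C : Configuration 0 q Blue A B) where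
  open Configuration C
  open VertexTypes C
  open LocalBound C

  ω≤30 : ∀ {e x} → e ∈ₗ A → ¬ e ∈ₗ B → x ∈ e → NonFull e x → ω x ≤ 30
  ω≤30 e∈A e∉B x∈e nf with nonFull-type e∈A e∉B x∈e nf
  ... | inj₁ s   = ≤-trans (share-q≥2 0 (nonFull⇒2≤t e∈A x∈e nf) (simple⇒2≤q s)) (m≤m+n 24 6)
  ... | inj₂ 3≤t = 3≤t⇒ω 3≤t

  -- The critical case: `y` lies in no member of `A` or `B` but `e` and may take a share of 48, so
  -- each end of the non-blue pair must be held to 24. What helps is that xy is blue.
  module _ {e x z y} (e∈A : e ∈ₗ A) (e∉B : ¬ e ∈ₗ B) (x∈e : x ∈ e) (z∈e : z ∈ e) (z≢x : z ≢ x)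
           (¬xz : ¬ Blue x z) (only : ∀ {g} → g ∈ₗ A → x ∈ g → z ∈ g → g ≡ e)
           (y∈e : y ∈ e) (y≢x : y ≢ x) (y-full : Full e y) (t-y : t y ≡ 1) where

    private
      xy : Blue x y
      xy = blue-sym (y-full x∈e (y≢x ∘ sym))

      only-e : ∀ {g} → g ∈ₗ A → y ∈ g → g ≡ e
      only-e g∈A y∈g = deg≤1⇒≡ (≤-trans (m≤m+n _ _) (≤-reflexive t-y)) g∈A y∈g e∈A y∈e

    -- Starting from a B-edge b through xz, the cover alternates: some u ∈ b lies
    -- in another A-edge g, and some w ∈ g needs yet another B-edge.
    t≡3⇒2≤q : t x ≡ 3 → 2 ≤ q x
    t≡3⇒2≤q t≡3 with coverᴬ e∈A x∈e z∈e z≢x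
    ... | inj₁ xz = ⊥-elim (¬xz xz)
    ... | inj₂ (b , b∈B , x∈b , z∈b) with ≢⇒∃∉ {p = b} {e} (λ { refl → e∉B b∈B }) (trans (sizeᴮ b∈B) (sym (sizeᴬ e∈A)))
    ...   | u , u∈b , u∉e with coverᴮ b∈B x∈b u∈b (λ { refl → u∉e x∈e })
    ...     | inj₁ xu = blue⇒2≤q y≢x xy (λ { refl → u∉e x∈e }) xu (λ { refl → u∉e y∈e })
    ...     | inj₂ (g , g∈A , x∈g , u∈g) with ≢⇒∃∉ {p = g} {b} (λ { refl → g≢e (only g∈A x∈g z∈b) }) (trans (sizeᴬ g∈A) (sym (sizeᴮ b∈B)))
      where
      g≢e : g ≢ e
      g≢e refl = u∉e u∈g
    ...       | w , w∈g , w∉b with coverᴬ g∈A x∈g w∈g (λ { refl → w∉b x∈b })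
    ...         | inj₁ xw = blue⇒2≤q y≢x xy (λ { refl → w∉b x∈b }) xw
                              (λ { refl → u∉e (subst (u ∈_) (only-e g∈A w∈g) u∈g) })
    ...         | inj₂ (b′ , b′∈B , x∈b′ , w∈b′) = ⊥-elim (4≰3 (subst (4 ≤_) t≡3
                    (+-mono-≤ (2≤deg e∈A x∈e g∈A x∈g λ { refl → u∉e u∈g }) (2≤deg b∈B x∈b b′∈B x∈b′ λ { refl → w∉b w∈b′ }))))
      where
      4≰3 : ¬ 4 ≤ 3
      4≰3 (s≤s (s≤s (s≤s ())))

    ω≤24 : ω x ≤ 24
    ω≤24 with nonFull-type e∈A e∉B x∈e (z , z∈e , z≢x , ¬xz)
    ... | inj₁ s = share-q≥2 0 (nonFull⇒2≤t e∈A x∈e (z , z∈e , z≢x , ¬xz)) (simple⇒2≤q s)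
    ... | inj₂ 3≤t with 3≤-cases 3≤t
    ...   | inj₁ t≡3 = share-q≥2 0 (≤-trans (m≤m+n 2 1) 3≤t) (t≡3⇒2≤q t≡3)
    ...   | inj₂ 4≤t = ≤-trans (share-bound 0 {t = t x} {q = q x} 1 7 3 (multiplier≤3 4≤t) (blue⇒1≤q y≢x xy) refl) (m≤m+n 21 3)

  -- The ends of a private pair of `e` are non-full. The third vertex decides: if non-full, the
  -- total is at most 3 * 30; if full with t ≥ 2, at most 30 + 30 + 24; if full with t = 1, at most
  -- 24 + 24 + 48 = 96 = 12 M.
  proper-bound : ∀ {e} → e ∈ₗ A → ¬ e ∈ₗ B → S e ω ≤ 96
  proper-bound {e} e∈A e∉B with privateᴬ e∈A
  ... | x , z , x∈e , z∈e , z≢x , ¬xz , only with 1≤∣p∣⇒∃ (e - x - z) (≤-reflexive (sym (∣e-x-y∣ e∈A x∈e z∈e z≢x)))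
  ...   | y , y∈ = begin
      S e ω                                   ≡⟨ split₂ x∈e z∈e z≢x ⟩
      ω x + (ω z + S (e - x - z) ω)           ≡⟨ cong (λ s → ω x + (ω z + s)) (trans (S-split ω y∈) (cong (ω y +_) rest)) ⟩
      ω x + (ω z + (ω y + 0))                 ≤⟨ xzy ⟩
      96                                      ∎
      where
      open ≤-Reasoning
      y∈e = proj₁ (∈-x-y e y∈)
      y≢x = proj₁ (proj₂ (∈-x-y e y∈))
      y≢z = proj₂ (proj₂ (∈-x-y e y∈))
      nfx : NonFull e x
      nfx = z , z∈e , z≢x , ¬xz
      nfz : NonFull e z
      nfz = x , x∈e , z≢x ∘ sym , ¬xz ∘ blue-sym
      rest : S (e - x - z - y) ω ≡ 0
      rest = n≤0⇒n≡0 (≤-trans (S-bound (e - x - z - y) 0 λ w∈ → ⊥-elim (<⇒≱ (x∈p⇒1≤∣p∣ w∈)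
        (≤-reflexive (suc-injective (trans (sym (∣p∣≡suc∣p-x∣ y∈)) (∣e-x-y∣ e∈A x∈e z∈e z≢x))))))
        (≤-reflexive (*-zeroʳ ∣ e - x - z - y ∣)))
      xzy : ω x + (ω z + (ω y + 0)) ≤ 96
      xzy with full? e y
      ... | inj₂ nf = ≤-trans (+-mono-≤ (ω≤30 e∈A e∉B x∈e nfx) (+-mono-≤ (ω≤30 e∈A e∉B z∈e nfz)
                        (+-monoˡ-≤ 0 (ω≤30 e∈A e∉B y∈e nf)))) (m≤m+n 90 6)
      ... | inj₁ full with t y ≟ 1
      ...   | yes t-y = +-mono-≤ (ω≤24 e∈A e∉B x∈e z∈e z≢x ¬xz only y∈e y≢x full t-y)
                       (+-mono-≤ (ω≤24 e∈A e∉B z∈e x∈e (z≢x ∘ sym) (¬xz ∘ blue-sym) (λ g∈A z∈g x∈g → only g∈A x∈g z∈g) y∈e y≢z full t-y)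
                                 (+-monoˡ-≤ 0 (share-full 0 {t = t y} (full⇒q e∈A y∈e full))))
      ...   | no t-y = ≤-trans (+-mono-≤ (ω≤30 e∈A e∉B x∈e nfx) (+-mono-≤ (ω≤30 e∈A e∉B z∈e nfz)
                        (+-monoˡ-≤ 0 (share-q≥2 0 2≤t (full⇒q e∈A y∈e full))))) (m≤m+n 84 12)
        where
        2≤t : 2 ≤ t y
        2≤t = ≤∧≢⇒< (≤-trans (1≤deg e∈A y∈e) (m≤m+n _ _)) (t-y ∘ sym)

-- Hyperedges of size 4

module Dimension4 {q : Fin n → ℕ} {Blue : Fin n → Fin n → Set} {A B : List (Subset n)}
                  (C : Configuration 1 q Blue A B) where
  open Configuration C
  open VertexTypes C
  open LocalBound C

  module _ {e} (e∈A : e ∈ₗ A) (e∉B : ¬ e ∈ₗ B) where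

    ω≤48 : ∀ {x} → x ∈ e → NonFull e x → ω x ≤ 48
    ω≤48 x∈e nf with nonFull-type e∈A e∉B x∈e nf
    ... | inj₁ s   = share-q≥2 1 (nonFull⇒2≤t e∈A x∈e nf) (simple⇒2≤q s)
    ... | inj₂ 3≤t = ≤-trans (3≤t⇒ω′ ≤-refl 3≤t) (m≤m+n 44 4)

    ω≤60 : ∀ {x} → x ∈ e → ω x ≤ 60
    ω≤60 {x} x∈e with full? e x
    ... | inj₁ full = share-full 1 {t = t x} (full⇒q e∈A x∈e full)
    ... | inj₂ nf   = ≤-trans (ω≤48 x∈e nf) (m≤m+n 48 12)

    -- Two full vertices make two pairs at `x` blue, so t ≥ 3 leaves at most 4 * 8. If t = 2, a
    -- vertex of the hyperedge `b` outside `e` is a third blue neighbour, leaving at most 6 * 5.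
    ω≤32 : ∀ {x y f f′} → x ∈ e → y ∈ e → y ≢ x → ¬ Blue x y →
      f ∈ e → f ≢ x → Full e f → f′ ∈ e → f′ ≢ x → Full e f′ → f′ ≢ f → ω x ≤ 32
    ω≤32 {x} {y} {f} {f′} x∈e y∈e y≢x ¬xy f∈e f≢x f-full f′∈e f′≢x f′-full f′≢f
      with nonFull-type e∈A e∉B x∈e (y , y∈e , y≢x , ¬xy)
    ... | inj₂ 3≤t = share-bound 1 {t = t x} {q = q x} 2 8 4 (multiplier≤4 3≤t)
      (blue⇒2≤q f≢x (blue-sym (f-full x∈e (f≢x ∘ sym))) f′≢x (blue-sym (f′-full x∈e (f′≢x ∘ sym))) f′≢f) refl
    ... | inj₁ s with 1≤∣p∣⇒∃ _ (Simple.1≤∣b─e∣ s)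
    ...   | u , u∈ = ≤-trans (share-bound 1 {t = t x} {q = q x} 3 5 6
        (multiplier≤6 (nonFull⇒2≤t e∈A x∈e (y , y∈e , y≢x , ¬xy))) 3≤q refl) (m≤m+n 30 2)
      where
      open Simple s
      u∉e : u ∉ e
      u∉e = x∈p─q⇒x∉q b e u∈
      Y : Subset _
      Y = (⁅ f ⁆ ∪ ⁅ f′ ⁆) ∪ (b ─ e)
      Y-blue : ∀ {z} → z ∈ Y → z ≢ x × Blue x z
      Y-blue {z} z∈ with x∈p∪q⁻ (⁅ f ⁆ ∪ ⁅ f′ ⁆) (b ─ e) z∈
      ... | inj₂ z∈′ = blue z∈′
      ... | inj₁ z∈′ with x∈p∪q⁻ ⁅ f ⁆ ⁅ f′ ⁆ z∈′
      ...   | inj₁ z∈f with refl ← x∈⁅y⁆⇒x≡y f z∈f = f≢x , blue-sym (f-full x∈e (f≢x ∘ sym))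
      ...   | inj₂ z∈f with refl ← x∈⁅y⁆⇒x≡y f′ z∈f = f′≢x , blue-sym (f′-full x∈e (f′≢x ∘ sym))
      3≤q : 3 ≤ q x
      3≤q = ≤-trans (3≤∣p∣ {p = Y} (x∈p∪q⁺ (inj₁ (x∈p∪q⁺ {p = ⁅ f ⁆} (inj₁ (x∈⁅x⁆ f))))) (x∈p∪q⁺ (inj₁ (x∈p∪q⁺ {p = ⁅ f ⁆} (inj₂ (x∈⁅x⁆ f′)))))
                       (x∈p∪q⁺ {p = ⁅ f ⁆ ∪ ⁅ f′ ⁆} (inj₂ u∈))
                       f′≢f (λ { refl → u∉e f∈e }) (λ { refl → u∉e f′∈e }))
                    (blue≤q x Y Y-blue)

    -- Beyond a private pair, two vertices remain. If one of them is non-full, the total is at most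
    -- 3 * 48 + 60 = 204 = 12 M. Two full ones may cost 2 * 60, but lower the private pair to 2 *
    -- 32.
    proper-bound : S e ω ≤ 204
    proper-bound with privateᴬ e∈A
    ... | x , z , x∈e , z∈e , z≢x , ¬xz , _
      with two-elements (e - x - z) (≤-reflexive (sym (∣e-x-y∣ e∈A x∈e z∈e z≢x)))
    ...   | f , f′ , f∈ , f′∈ , f′≢f = ≤-trans (≤-reflexive split₄) bound
      where
      f∈e = proj₁ (∈-x-y e f∈)
      f≢x = proj₁ (proj₂ (∈-x-y e f∈))
      f≢z = proj₂ (proj₂ (∈-x-y e f∈))
      f′∈e = proj₁ (∈-x-y e f′∈)
      f′≢x = proj₁ (proj₂ (∈-x-y e f′∈))
      f′≢z = proj₂ (proj₂ (∈-x-y e f′∈))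
      nfx : NonFull e x
      nfx = z , z∈e , z≢x , ¬xz
      nfz : NonFull e z
      nfz = x , x∈e , z≢x ∘ sym , ¬xz ∘ blue-sym
      e₂ : Subset _
      e₂ = e - x - z
      f′∈e₂-f : f′ ∈ e₂ - f
      f′∈e₂-f = x∈p∧x≢y⇒x∈p-y f′∈ f′≢f
      rest : S (e₂ - f - f′) ω ≡ 0
      rest = n≤0⇒n≡0 (≤-trans (S-bound (e₂ - f - f′) 0 λ w∈ → ⊥-elim (<⇒≱ (x∈p⇒1≤∣p∣ w∈)
        (≤-reflexive (suc-injective (trans (sym (∣p∣≡suc∣p-x∣ f′∈e₂-f)) (suc-injective (trans (sym (∣p∣≡suc∣p-x∣ f∈)) (∣e-x-y∣ e∈A x∈e z∈e z≢x))))))))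
        (≤-reflexive (*-zeroʳ ∣ e₂ - f - f′ ∣)))
      split₄ : S e ω ≡ ω x + (ω z + (ω f + (ω f′ + 0)))
      split₄ = trans (split₂ x∈e z∈e z≢x) (cong (λ s → ω x + (ω z + s))
        (trans (S-split ω f∈) (cong (ω f +_) (trans (S-split ω f′∈e₂-f) (cong (ω f′ +_) rest)))))
      bound : ω x + (ω z + (ω f + (ω f′ + 0))) ≤ 204
      bound with full? e f | full? e f′
      ... | inj₂ nf | _ = +-mono-≤ (ω≤48 x∈e nfx) (+-mono-≤ (ω≤48 z∈e nfz) (+-mono-≤ (ω≤48 f∈e nf) (+-monoˡ-≤ 0 (ω≤60 f′∈e))))
      ... | inj₁ _ | inj₂ nf = +-mono-≤ (ω≤48 x∈e nfx) (+-mono-≤ (ω≤48 z∈e nfz) (+-mono-≤ (ω≤60 f∈e) (+-monoˡ-≤ 0 (ω≤48 f′∈e nf))))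
      ... | inj₁ full | inj₁ full′ = ≤-trans
        (+-mono-≤ (ω≤32 x∈e z∈e z≢x ¬xz f∈e f≢x full f′∈e f′≢x full′ f′≢f)
        (+-mono-≤ (ω≤32 z∈e x∈e (z≢x ∘ sym) (¬xz ∘ blue-sym) f∈e f≢z full f′∈e f′≢z full′ f′≢f)
        (+-mono-≤ (ω≤60 f∈e) (+-monoˡ-≤ 0 (ω≤60 f′∈e))))) (m≤m+n 184 20)

-- Hyperedges of size at least 5

module Dimension≥5 {m : ℕ} (2≤m : 2 ≤ m) {q : Fin n → ℕ} {Blue : Fin n → Fin n → Set} {A B : List (Subset n)}
                   (C : Configuration m q Blue A B) where
  open Configuration C
  open VertexTypes C
  open LocalBound C

  private
    1≤m : 1 ≤ m
    1≤m = ≤-trans (s≤s z≤n) 2≤m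

    -- Equivalent to m ≥ 2. This distinguishes the range d ≥ 5: full vertices no longer exceed the
    -- general bound 24(d - 2).
    full≤nonFull : 12 * (4 + m) ≤ 24 * (1 + m)
    full≤nonFull = ≤-trans (≤-reflexive (eq₁ m)) (≤-trans (+-monoʳ-≤ (12 * m + 24) (*-monoʳ-≤ 12 2≤m)) (≤-reflexive (eq₂ m)))
      where
      eq₁ : ∀ m → 12 * (4 + m) ≡ (12 * m + 24) + 12 * 2
      eq₁ = solve-∀
      eq₂ : ∀ m → (12 * m + 24) + 12 * m ≡ 24 * (1 + m)
      eq₂ = solve-∀

    heavy≤ : 16 * m + 28 ≤ 24 * (1 + m)
    heavy≤ = ≤-trans (≤-trans (m≤m+n _ 4) (≤-reflexive (eq₁ m)))
      (≤-trans (+-monoʳ-≤ (16 * m + 24) (*-monoʳ-≤ 8 1≤m)) (≤-reflexive (eq₂ m)))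
      where
      eq₁ : ∀ m → (16 * m + 28) + 4 ≡ (16 * m + 24) + 8 * 1
      eq₁ = solve-∀
      eq₂ : ∀ m → (16 * m + 24) + 8 * m ≡ 24 * (1 + m)
      eq₂ = solve-∀

  module _ {e} (e∈A : e ∈ₗ A) (e∉B : ¬ e ∈ₗ B) where

    ω≤ : ∀ {x} → x ∈ e → ω x ≤ 24 * (1 + m)
    ω≤ {x} x∈e with full? e x
    ... | inj₁ full = ≤-trans (share-full m {t = t x} (full⇒q e∈A x∈e full)) full≤nonFull
    ... | inj₂ nf with nonFull-type e∈A e∉B x∈e nf
    ...   | inj₁ s   = share-q≥2 m (nonFull⇒2≤t e∈A x∈e nf) (simple⇒2≤q s)
    ...   | inj₂ 3≤t = ≤-trans (3≤t⇒ω′ 1≤m 3≤t) heavy≤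

    -- The threshold is the bound for a full vertex. One light vertex suffices, as 12(d + 1) + (d -
    -- 1) * 24(d - 2) equals 12 M.
    Light : Fin n → Set
    Light x = x ∈ e × ω x ≤ 12 * (4 + m)

    -- Two vertices with t ≥ 3 save enough as well: 2(16m + 28) + 24(m + 1)² stays below 12 M by 4m
    -- + 16.
    TwoHeavy : Set
    TwoHeavy = ∃ λ x → ∃ λ y → x ∈ e × y ∈ e × y ≢ x × 3 ≤ t x × 3 ≤ t y

    twoHeavy? : Dec TwoHeavy
    twoHeavy? = Fin.any? λ x → Fin.any? λ y →
      x ∈? e ×-dec y ∈? e ×-dec ¬? (y Fin.≟ x) ×-dec 3 ≤? t x ×-dec 3 ≤? t y

    module NotLight (¬light : ¬ ∃ Light) (¬twoHeavy : ¬ TwoHeavy) where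

      nonFull : ∀ {x} → x ∈ e → NonFull e x
      nonFull {x} x∈e with full? e x
      ... | inj₁ full = ⊥-elim (¬light (x , x∈e , share-full m {t = t x} (full⇒q e∈A x∈e full)))
      ... | inj₂ nf   = nf

      type : ∀ {x} → x ∈ e → Simple e x ⊎ 3 ≤ t x
      type x∈e = nonFull-type e∈A e∉B x∈e (nonFull x∈e)

      -- If 3p ≥ m + 1, then 3q ≥ 6p ≥ 2(m + 1), so at most 2(d + 1) of the demand remains. As t ≥
      -- 2, the multiplier is at most 6 and the vertex would be light.
      3p≤m : ∀ {x} → x ∈ e → (s : Simple e x) → 3 * ∣ e ─ Simple.b s ∣ ≤ m
      3p≤m {x} x∈e s with 3 * ∣ e ─ Simple.b s ∣ ≤? m
      ... | yes le = le
      ... | no ¬le = ⊥-elim (¬light (x , x∈e , (begin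
        multiplier (t x) * (2 * N m ∸ 3 * q x) ≤⟨ *-mono-≤ (multiplier≤6 (nonFull⇒2≤t e∈A x∈e (nonFull x∈e))) D≤ ⟩
        6 * (8 + 2 * m)                        ≡⟨ eq₂ m ⟩
        12 * (4 + m)                           ∎)))
        where
        open ≤-Reasoning
        open Simple s
        p = ∣ e ─ b ∣
        eq₁ : ∀ m → 2 * (5 + 2 * m) ≡ 2 * suc m + (8 + 2 * m)
        eq₁ = solve-∀
        eq₂ : ∀ m → 6 * (8 + 2 * m) ≡ 12 * (4 + m)
        eq₂ = solve-∀
        eq₃ : ∀ p → 2 * (3 * p) ≡ 3 * (p + p)
        eq₃ = solve-∀
        D≤ : 2 * N m ∸ 3 * q x ≤ 8 + 2 * m
        D≤ = m≤n+o⇒m∸n≤o _ (3 * q x) (begin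
          2 * N m                     ≡⟨ eq₁ m ⟩
          2 * suc m + (8 + 2 * m)     ≤⟨ +-monoˡ-≤ (8 + 2 * m) (*-monoʳ-≤ 2 (≰⇒> ¬le)) ⟩
          2 * (3 * p) + (8 + 2 * m)   ≡⟨ cong (_+ (8 + 2 * m)) (eq₃ p) ⟩
          3 * (p + p) + (8 + 2 * m)   ≤⟨ +-monoˡ-≤ (8 + 2 * m) (*-monoʳ-≤ 3 2p≤q) ⟩
          3 * q x + (8 + 2 * m)       ∎)

      -- Two edges of B each missing at most (d-3)/3 vertices of e meet in two vertices of e.
      same-b : ∀ {x y} → x ∈ e → y ∈ e → (s : Simple e x) (s′ : Simple e y) → Simple.b s ≡ Simple.b s′
      same-b x∈e y∈e s s′ with Simple.b s ≟ₛ Simple.b s′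
      ... | yes b≡b′ = b≡b′
      ... | no  b≢b′ with 2 ≤? ∣ e ∩ Simple.b s ∩ Simple.b s′ ∣
      ...   | yes 2≤ with u , v , u∈ , v∈ , v≢u ← two-elements (e ∩ Simple.b s ∩ Simple.b s′) 2≤ =
        ⊥-elim (¬twoHeavy (u , v , ∈e u∈ , ∈e v∈ , v≢u , heavy u∈ , heavy v∈))
        where
        I : Subset n
        I = e ∩ Simple.b s ∩ Simple.b s′
        ∈e : ∀ {u} → u ∈ I → u ∈ e
        ∈e = p∩q⊆p e _
        heavy : ∀ {u} → u ∈ I → 3 ≤ t u
        heavy u∈ with u∈e , u∈bb′ ← x∈p∩q⁻ e _ u∈ with u∈b , u∈b′ ← x∈p∩q⁻ (Simple.b s) _ u∈bb′ =
          +-mono-≤ (1≤deg e∈A u∈e) (2≤deg (Simple.b∈B s) u∈b (Simple.b∈B s′) u∈b′ b≢b′)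
      -- Otherwise d ≤ p + p′ + 1 with 3p and 3p′ at most m, so 3d ≤ 2m + 3 = 2d - 3, which is
      -- absurd.
      ...   | no ¬2≤ = ⊥-elim (<⇒≱ (≤-trans (≤-from-≡ (m + 5) (eq m)) (*-monoʳ-≤ 3 (≤-trans (≤-reflexive (sym (sizeᴬ e∈A)))
          (≤-trans (∣p∣≤∣p─q∣+∣p─r∣+∣p∩q∩r∣ e (Simple.b s) (Simple.b s′))
                   (+-monoʳ-≤ (∣ e ─ Simple.b s ∣ + ∣ e ─ Simple.b s′ ∣) (≤-pred (≰⇒> ¬2≤)))))))
          (≤-trans (≤-reflexive (eq′ ∣ e ─ Simple.b s ∣ ∣ e ─ Simple.b s′ ∣))
                   (+-monoˡ-≤ 3 (+-mono-≤ (3p≤m x∈e s) (3p≤m y∈e s′)))))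
        where
        eq : ∀ m → 3 * (3 + m) ≡ suc (m + m + 3) + (m + 5)
        eq = solve-∀
        eq′ : ∀ p p′ → 3 * (p + p′ + 1) ≡ 3 * p + 3 * p′ + 3
        eq′ = solve-∀

      ∃simple : ∃ λ x → x ∈ e × Simple e x
      ∃simple with x , y , x∈e , y∈e , y≢x ← two-elements e (subst (2 ≤_) (sym (sizeᴬ e∈A)) (s≤s (s≤s z≤n)))
        with type x∈e | type y∈e
      ... | inj₁ s | _      = x , x∈e , s
      ... | inj₂ _ | inj₁ s = y , y∈e , s
      ... | inj₂ h | inj₂ h′ = ⊥-elim (¬twoHeavy (x , y , x∈e , y∈e , y≢x , h , h′))

      -- All simple vertices share one hyperedge `b`, so a vertex `y` of `e` outside `b` has t ≥ 3.
      -- A non-blue partner `z` of `y` in `e` cannot be a second such vertex and is simple. The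
      -- member of `B` covering yz is then `b`, although `y` is not in `b`.
      impossible : Empty.⊥
      impossible with x , x∈e , s ← ∃simple
        with y , y∈ ← 1≤∣p∣⇒∃ (e ─ Simple.b s) (Simple.1≤p s)
        with y∈e ← p─q⊆p e _ y∈ | y∉b ← x∈p─q⇒x∉q e (Simple.b s) y∈
        with type y∈e
      ... | inj₁ s′ = y∉b (subst (y ∈_) (sym (same-b x∈e y∈e s s′)) (Simple.x∈b s′))
      ... | inj₂ 3≤t with z , z∈e , z≢y , ¬yz ← nonFull y∈e
        with b′ , b′∈B , y∈b′ , z∈b′ ← nonFull⇒cover e∈A y∈e (z , z∈e , z≢y , ¬yz)
        with type z∈e
      ...   | inj₂ 3≤t′ = ¬twoHeavy (y , z , y∈e , z∈e , z≢y , 3≤t , 3≤t′)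
      ...   | inj₁ s′   = y∉b (subst (y ∈_) (trans (Simple.only-b s′ b′∈B z∈b′) (sym (same-b x∈e z∈e s s′))) y∈b′)

    proper-bound : S e ω ≤ 12 * M m
    proper-bound with Fin.any? (λ x → x ∈? e ×-dec ω x ≤? 12 * (4 + m)) | twoHeavy?
    ... | no ¬light | no ¬twoHeavy = ⊥-elim (NotLight.impossible ¬light ¬twoHeavy)
    ... | yes (x , x∈e , light) | _ = begin
      S e ω                                             ≡⟨ S-split ω x∈e ⟩
      ω x + S (e - x) ω                                 ≤⟨ +-mono-≤ light (S-bound (e - x) (24 * (1 + m)) (ω≤ ∘ p─q⊆p e _)) ⟩
      12 * (4 + m) + ∣ e - x ∣ * (24 * (1 + m))         ≡⟨ cong (λ c → 12 * (4 + m) + c * (24 * (1 + m)))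
                                                            (suc-injective (trans (sym (∣p∣≡suc∣p-x∣ x∈e)) (sizeᴬ e∈A))) ⟩
      12 * (4 + m) + (2 + m) * (24 * (1 + m))           ≡⟨ eq m ⟩
      12 * M m                                          ∎
      where
      open ≤-Reasoning
      eq : ∀ m → 12 * (4 + m) + (2 + m) * (24 * (1 + m)) ≡ 12 * (suc m * (5 + 2 * m) + 3)
      eq = solve-∀
    ... | no _ | yes (x , y , x∈e , y∈e , y≢x , h , h′) = begin
      S e ω                                             ≡⟨ split₂ x∈e y∈e y≢x ⟩
      ω x + (ω y + S (e - x - y) ω)                     ≤⟨ +-mono-≤ (3≤t⇒ω′ 1≤m h) (+-mono-≤ (3≤t⇒ω′ 1≤m h′)
                                                            (S-bound (e - x - y) (24 * (1 + m)) (ω≤ ∘ proj₁ ∘ ∈-x-y e))) ⟩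
      (16 * m + 28) + ((16 * m + 28) + ∣ e - x - y ∣ * (24 * (1 + m)))
        ≡⟨ cong (λ c → (16 * m + 28) + ((16 * m + 28) + c * (24 * (1 + m)))) (∣e-x-y∣ e∈A x∈e y∈e y≢x) ⟩
      (16 * m + 28) + ((16 * m + 28) + (1 + m) * (24 * (1 + m)))
        ≤⟨ ≤-from-≡ (4 * m + 16) (eq m) ⟩
      12 * M m                                          ∎
      where
      open ≤-Reasoning
      eq : ∀ m → 12 * (suc m * (5 + 2 * m) + 3) ≡ ((16 * m + 28) + ((16 * m + 28) + (1 + m) * (24 * (1 + m)))) + (4 * m + 16)
      eq = solve-∀

-- Discharging over X

_∈ₗ?_ : (p : Subset n) (L : List (Subset n)) → Dec (p ∈ₗ L)
p ∈ₗ? L = Any.any? (p ≟ₛ_) L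

edge-bound : ∀ {m q Blue} {A B : List (Subset n)} → Configuration m q Blue A B →
  ∀ {e} → e ∈ₗ A → S e (λ x → share m (deg A x + deg B x) (q x)) ≤ 12 * M m
edge-bound {m = m} {B = B} C {e} e∈A with e ∈ₗ? B
... | yes e∈B = LocalBound.common-bound C e∈A e∈B
edge-bound {m = 0}           C e∈A | no e∉B = Dimension3.proper-bound C e∈A e∉B
edge-bound {m = 1}           C e∈A | no e∉B = Dimension4.proper-bound C e∈A e∉B
edge-bound {m = suc (suc m)} C e∈A | no e∉B = Dimension≥5.proper-bound (s≤s (s≤s z≤n)) C e∈A e∉B

-- Scaled by 12, the demand 24 N of a vertex is at most 36 q plus one share for each of its t
-- hyperedges. Summed over `X`, each member of `A` or `B` is charged at most 12 M, and |B| ≤ |A|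
-- bounds the charge of `B` by that of `A`.
total-bound : ∀ {m q Blue} {A B : List (Subset n)} → Configuration m q Blue A B →
  (X : Subset n) → (∀ {x} → x ∈ X → 1 ≤ deg A x + deg B x) → length B ≤ length A →
  2 * (N m * ∣ X ∣) ≤ 2 * (length A * M m) + 3 * S X q
total-bound {m = m} {q} {A = A} {B} C X 1≤t B≤A = *-cancelˡ-≤ 12 (begin
  12 * (2 * (N m * ∣ X ∣))
    ≡⟨ eq₁ (N m) ∣ X ∣ ⟩
  ∣ X ∣ * (12 * (2 * N m))
    ≡⟨ S-const X (12 * (2 * N m)) ⟨
  S X (λ _ → 12 * (2 * N m))
    ≤⟨ S-mono X pointwise ⟩
  S X (λ x → 36 * q x + (deg A x * ω x + deg B x * ω x))
    ≡⟨ trans (S-+ X _ _) (cong₂ _+_ (S-* X 36 q) (S-+ X _ _)) ⟩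
  36 * S X q + (S X (λ x → deg A x * ω x) + S X (λ x → deg B x * ω x))
    ≤⟨ +-monoʳ-≤ (36 * S X q) (+-mono-≤ (charge A (edge-bound C)) (charge B boundᴮ)) ⟩
  36 * S X q + (length A * (12 * M m) + length B * (12 * M m))
    ≤⟨ +-monoʳ-≤ (36 * S X q) (+-monoʳ-≤ (length A * (12 * M m)) (*-monoˡ-≤ (12 * M m) B≤A)) ⟩
  36 * S X q + (length A * (12 * M m) + length A * (12 * M m))
    ≡⟨ eq₂ (S X q) (length A) (M m) ⟩
  12 * (2 * (length A * M m) + 3 * S X q) ∎)
  where
  open ≤-Reasoning
  t ω : Fin _ → ℕ
  t x = deg A x + deg B x
  ω x = share m (t x) (q x)
  eq₁ : ∀ N x → 12 * (2 * (N * x)) ≡ x * (12 * (2 * N))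
  eq₁ = solve-∀
  eq₂ : ∀ s a M → 36 * s + (a * (12 * M) + a * (12 * M)) ≡ 12 * (2 * (a * M) + 3 * s)
  eq₂ = solve-∀
  eq₃ : ∀ q d → 12 * (3 * q + d) ≡ 36 * q + 12 * d
  eq₃ = solve-∀
  pointwise : ∀ {x} → x ∈ X → 12 * (2 * N m) ≤ 36 * q x + (deg A x * ω x + deg B x * ω x)
  pointwise {x} x∈X = begin
    12 * (2 * N m)                                      ≤⟨ *-monoʳ-≤ 12 (m≤n+m∸n (2 * N m) (3 * q x)) ⟩
    12 * (3 * q x + D)                                  ≡⟨ eq₃ (q x) D ⟩
    36 * q x + 12 * D                                   ≤⟨ +-monoʳ-≤ (36 * q x) (*-monoˡ-≤ D (12≤t*multiplier (1≤t x∈X))) ⟩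
    36 * q x + t x * multiplier (t x) * D               ≡⟨ cong (36 * q x +_) (*-assoc (t x) (multiplier (t x)) D) ⟩
    36 * q x + t x * ω x                                ≡⟨ cong (36 * q x +_) (*-distribʳ-+ (ω x) (deg A x) (deg B x)) ⟩
    36 * q x + (deg A x * ω x + deg B x * ω x)          ∎
    where D = 2 * N m ∸ 3 * q x
  boundᴮ : ∀ {g} → g ∈ₗ B → S g ω ≤ 12 * M m
  boundᴮ {g} g∈B = ≤-trans
    (S-mono g λ {x} _ → ≤-reflexive (cong (λ t → share m t (q x)) (+-comm (deg A x) (deg B x))))
    (edge-bound (swap-configuration C) g∈B)
  charge : (L : List (Subset _)) → (∀ {g} → g ∈ₗ L → S g ω ≤ 12 * M m) →
    S X (λ x → deg L x * ω x) ≤ length L * (12 * M m)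
  charge L bound = ≤-trans (≤-reflexive (S-wdeg (λ _ → 1) L X ω)) (∑-bound L (12 * M m) λ {g} g∈L →
    ≤-trans (≤-reflexive (*-identityˡ (S (X ∩ g) ω))) (≤-trans (S-⊆ X g ω) (bound g∈L)))

-- A hyperedge with s vertices in X and r outside pays 3 (s - 1) to each of its
-- vertices in X; the slack is a (4c + a + 1) for s = 2 + a, r = 1 + c.
trace-bound : ∀ {m s r} → 2 ≤ s → 1 ≤ r → s + r ≡ 3 + m → 2 * (N m * r) + 3 * ((s ∸ 1) * (s * 1)) ≤ 2 * M m
trace-bound {m} {suc (suc a)} {suc c} _ _ s+r≡ = subst Bound a+c≡m bound
  where
  Bound : ℕ → Set
  Bound m = 2 * (N m * suc c) + 3 * (suc a * (suc (suc a) * 1)) ≤ 2 * M m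
  a+c≡m : a + c ≡ m
  a+c≡m = +-cancelˡ-≡ 3 (a + c) m (trans (cong (2 +_) (sym (+-suc a c))) s+r≡)
  eq : ∀ a c → 2 * (suc (a + c) * (5 + 2 * (a + c)) + 3) ≡
    (2 * ((5 + 2 * (a + c)) * suc c) + 3 * (suc a * (suc (suc a) * 1))) + a * (4 * c + a + 1)
  eq = solve-∀
  bound : Bound (a + c)
  bound = ≤-from-≡ (a * (4 * c + a + 1)) (eq a c)
trace-bound {s = suc zero} (s≤s ()) _ _

-- Unions and covers by hyperedges

⊆⋃ : {L : List (Subset n)} {g : Subset n} → g ∈ₗ L → g ⊆ ⋃ L
⊆⋃ (here refl) x∈g = x∈p∪q⁺ (inj₁ x∈g)
⊆⋃ {L = p ∷ L} (there g∈L) x∈g = x∈p∪q⁺ {p = p} (inj₂ (⊆⋃ g∈L x∈g))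

∈⋃⇒∃ : (L : List (Subset n)) {x : Fin n} → x ∈ ⋃ L → ∃ λ g → g ∈ₗ L × x ∈ g
∈⋃⇒∃ []      x∈⊥ = ⊥-elim (∉⊥ x∈⊥)
∈⋃⇒∃ (p ∷ L) x∈ with x∈p∪q⁻ p (⋃ L) x∈
... | inj₁ x∈p = p , here refl , x∈p
... | inj₂ x∈L with g , g∈L , x∈g ← ∈⋃⇒∃ L x∈L = g , there g∈L , x∈g

spanned : Subset n → List (Subset n) → Subset n
spanned = foldr _∪_

⊆spanned : (X : Subset n) (L : List (Subset n)) → X ⊆ spanned X L
⊆spanned X []      x∈X = x∈X
⊆spanned X (g ∷ L) x∈X = x∈p∪q⁺ {p = g} (inj₂ (⊆spanned X L x∈X))

edge⊆spanned : (X : Subset n) {L : List (Subset n)} {g : Subset n} → g ∈ₗ L → g ⊆ spanned X L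
edge⊆spanned X (here refl) x∈g = x∈p∪q⁺ (inj₁ x∈g)
edge⊆spanned X {p ∷ L} (there g∈L) x∈g = x∈p∪q⁺ {p = p} (inj₂ (edge⊆spanned X g∈L x∈g))

-- The set built so far contains `X`, so `g` adds at most |g ─ X| vertices; overlaps outside `X`
-- only lower the count.
∣spanned∣ : (X : Subset n) (L : List (Subset n)) → ∣ spanned X L ∣ ≤ ∣ X ∣ + ∑ L (λ g → ∣ g ─ X ∣)
∣spanned∣ X []      = m≤m+n ∣ X ∣ 0
∣spanned∣ X (g ∷ L) = begin
  ∣ g ∪ spanned X L ∣                              ≤⟨ ∣p∪q∣≤∣q∣+∣p─q∣ g (spanned X L) ⟩
  ∣ spanned X L ∣ + ∣ g ─ spanned X L ∣            ≤⟨ +-mono-≤ (∣spanned∣ X L) (p⊆q⇒∣p∣≤∣q∣ λ x∈ →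
                                                       x∈p∧x∉q⇒x∈p─q (p─q⊆p g _ x∈) (x∈p─q⇒x∉q g _ x∈ ∘ ⊆spanned X L)) ⟩
  ∣ X ∣ + ∑ L (λ g → ∣ g ─ X ∣) + ∣ g ─ X ∣        ≡⟨ eq ∣ X ∣ _ _ ⟩
  ∣ X ∣ + (∣ g ─ X ∣ + ∑ L (λ g → ∣ g ─ X ∣))      ∎
  where
  open ≤-Reasoning
  eq : ∀ a b c → a + b + c ≡ a + (c + b)
  eq = solve-∀

-- Induction over `L`: the elements of `Y` in `g` are vertices of X ∩ g other than `x`, which
-- accounts for the - 1; the rest of `Y` is covered by the remaining hyperedges.
wdeg-cover : (X : Subset n) (L : List (Subset n)) {x : Fin n} → x ∈ X → (Y : Subset n) →
  (∀ {y} → y ∈ Y → y ≢ x × y ∈ X × Any (λ g → x ∈ g × y ∈ g) L) →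
  ∣ Y ∣ ≤ wdeg (λ g → ∣ X ∩ g ∣ ∸ 1) L x
wdeg-cover X [] x∈X Y Y-cov = ≮⇒≥ λ 1≤Y → case-[] (proj₂ (proj₂ (Y-cov (proj₂ (1≤∣p∣⇒∃ Y 1≤Y)))))
  where
  case-[] : ∀ {P : Subset _ → Set} → ¬ Any P []
  case-[] ()
wdeg-cover X (g ∷ L) {x} x∈X Y Y-cov with x ∈? g
... | no x∉g = ≤-trans (wdeg-cover X L x∈X Y λ y∈ → map₂ (map₂ λ { (here (x∈g , _)) → ⊥-elim (x∉g x∈g) ; (there a) → a }) (Y-cov y∈))
                 (m≤n+m _ (𝟙 g x * _))
... | yes x∈g = begin
  ∣ Y ∣                                       ≡⟨ ∣p∩q∣+∣q─p∣≡∣q∣ g Y ⟨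
  ∣ g ∩ Y ∣ + ∣ Y ─ g ∣                       ≤⟨ +-mono-≤ first rest ⟩
  (∣ X ∩ g ∣ ∸ 1) + wdeg w L x                ≡⟨ cong (_+ wdeg w L x) (*-identityˡ (∣ X ∩ g ∣ ∸ 1)) ⟨
  1 * (∣ X ∩ g ∣ ∸ 1) + wdeg w L x            ≡⟨ cong (λ i → i * (∣ X ∩ g ∣ ∸ 1) + wdeg w L x) (∈⇒𝟙 x∈g) ⟨
  wdeg w (g ∷ L) x                            ∎
  where
  open ≤-Reasoning
  w : Subset _ → ℕ
  w g = ∣ X ∩ g ∣ ∸ 1
  first : ∣ g ∩ Y ∣ ≤ ∣ X ∩ g ∣ ∸ 1
  first = subst (∣ g ∩ Y ∣ ≤_) (cong (_∸ 1) (sym (∣p∣≡suc∣p-x∣ (x∈p∩q⁺ (x∈X , x∈g)))))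
    (p⊆q⇒∣p∣≤∣q∣ λ y∈ → let y∈g , y∈Y = x∈p∩q⁻ g Y y∈ ; y≢x , y∈X , _ = Y-cov y∈Y in
      x∈p∧x≢y⇒x∈p-y (x∈p∩q⁺ (y∈X , y∈g)) y≢x)
  rest : ∣ Y ─ g ∣ ≤ wdeg w L x
  rest = wdeg-cover X L x∈X (Y ─ g) λ y∈ →
    map₂ (map₂ λ { (here (_ , y∈g)) → ⊥-elim (x∈p─q⇒x∉q Y g y∈ y∈g) ; (there a) → a }) (Y-cov (p─q⊆p Y g y∈))

unique-⊆⇒length≤ : {xs ys : List (Subset n)} → Unique xs → (∀ {g} → g ∈ₗ xs → g ∈ₗ ys) → length xs ≤ length ys
unique-⊆⇒length≤ {xs = []} _ _ = z≤n
unique-⊆⇒length≤ {xs = x ∷ xs} {ys} (x∉xs ∷ uxs) xs⊆ys = ≤-trans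
  (s≤s (unique-⊆⇒length≤ uxs λ g∈xs →
    ∈-filter⁺ (¬? ∘ (_≟ₛ x)) (xs⊆ys (there g∈xs)) (All.lookup x∉xs g∈xs ∘ sym)))
  (List.filter-notAll (¬? ∘ (_≟ₛ x)) ys (Any.map (λ { refl ¬refl → ¬refl refl }) (xs⊆ys (here refl))))

length-filter+ : {P : Subset n → Set} (P? : ∀ g → Dec (P g)) (L : List (Subset n)) →
  length (filter P? L) + length (filter (¬? ∘ P?) L) ≡ length L
length-filter+ P? []      = refl
length-filter+ P? (g ∷ L) with does (P? g)
... | true  = cong suc (length-filter+ P? L)
... | false = trans (+-suc _ _) (cong suc (length-filter+ P? L))

-- Density at least N / M, with denominators cleared.
Dense : ℕ → Hypergraph n → Set
Dense m h = Σ (SubHypergraph h) λ K → N m * ∣ verts K ∣ ≤ M m * length (kedges K)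

-- Hyperedges without such a pair are the redundant ones: each of their pairs is covered elsewhere.
Private : List (Subset n) → Subset n → Set
Private L e = ∃ λ x → ∃ λ y → x ∈ e × y ∈ e × y ≢ x × (∀ {g} → g ∈ₗ L → x ∈ g → y ∈ g → g ≡ e)

-- Comparing two irredundant preimages

module Comparison {m n : ℕ} (h H : Hypergraph n) (uniform-h : Uniform (3 + m) h) (uniform-H : Uniform (3 + m) H)
  (h→H : ∀ {x y} → ProjAdj h x y → ProjAdj H x y) (H→h : ∀ {x y} → ProjAdj H x y → ProjAdj h x y)
  (private-h : ∀ {e} → e ∈ₗ edges h → Private (edges h) e) (private-H : ∀ {e} → e ∈ₗ edges H → Private (edges H) e)
  (eH≤eh : e H ≤ e h) (h≁H : ¬ SameHypergraph h H) where

  Δ₁ Δ₂ : List (Subset n)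
  Δ₁ = filter (λ g → ¬? (g ∈ₗ? edges H)) (edges h)
  Δ₂ = filter (λ g → ¬? (g ∈ₗ? edges h)) (edges H)

  -- Every edge not inside X belongs to both hypergraphs.
  X : Subset n
  X = ⋃ Δ₁ ∪ ⋃ Δ₂

  Inside : Subset n → Set
  Inside g = ∀ x → x ∈ g → x ∈ X

  inside? : ∀ g → Dec (Inside g)
  inside? g = map′ (λ g⊆X x → g⊆X {x}) (λ g⊆X {x} → g⊆X x) (g ⊆? X)

  -- A hyperedge meeting `X` in a single vertex covers no pair of `X` and is left out.
  Touching : Subset n → Set
  Touching g = ¬ Inside g × 2 ≤ ∣ X ∩ g ∣

  touching? : ∀ g → Dec (Touching g)
  touching? g = ¬? (inside? g) ×-dec 2 ≤? ∣ X ∩ g ∣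

  A B T : List (Subset n)
  A = filter inside? (edges h)
  B = filter inside? (edges H)
  -- Filtering `edges H` would yield the same members, since hyperedges not inside `X` are shared.
  T = filter touching? (edges h)

  Δ₁-inside : ∀ {g} → g ∈ₗ edges h → ¬ g ∈ₗ edges H → Inside g
  Δ₁-inside g∈h g∉H x x∈g = x∈p∪q⁺ (inj₁ (⊆⋃ (∈-filter⁺ _ g∈h g∉H) x∈g))

  Δ₂-inside : ∀ {g} → g ∈ₗ edges H → ¬ g ∈ₗ edges h → Inside g
  Δ₂-inside g∈H g∉h x x∈g = x∈p∪q⁺ {p = ⋃ Δ₁} (inj₂ (⊆⋃ (∈-filter⁺ _ g∈H g∉h) x∈g))

  outside-h⇒H : ∀ {g} → g ∈ₗ edges h → ¬ Inside g → g ∈ₗ edges H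
  outside-h⇒H {g} g∈h ¬in = decidable-stable (g ∈ₗ? edges H) (¬in ∘ Δ₁-inside g∈h)

  outside-H⇒h : ∀ {g} → g ∈ₗ edges H → ¬ Inside g → g ∈ₗ edges h
  outside-H⇒h {g} g∈H ¬in = decidable-stable (g ∈ₗ? edges h) (¬in ∘ Δ₂-inside g∈H)

  X-edge : ∀ {x} → x ∈ X → ∃ λ g → x ∈ g × ((g ∈ₗ A × ¬ g ∈ₗ edges H) ⊎ (g ∈ₗ B × ¬ g ∈ₗ edges h))
  X-edge x∈X with x∈p∪q⁻ (⋃ Δ₁) (⋃ Δ₂) x∈X
  ... | inj₁ x∈ with g , g∈Δ , x∈g ← ∈⋃⇒∃ Δ₁ x∈ with g∈h , g∉H ← ∈-filter⁻ (λ g → ¬? (g ∈ₗ? edges H)) {xs = edges h} g∈Δ =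
    g , x∈g , inj₁ (∈-filter⁺ inside? g∈h (Δ₁-inside g∈h g∉H) , g∉H)
  ... | inj₂ x∈ with g , g∈Δ , x∈g ← ∈⋃⇒∃ Δ₂ x∈ with g∈H , g∉h ← ∈-filter⁻ (λ g → ¬? (g ∈ₗ? edges h)) {xs = edges H} g∈Δ =
    g , x∈g , inj₂ (∈-filter⁺ inside? g∈H (Δ₂-inside g∈H g∉h) , g∉h)

  Blue : Fin n → Fin n → Set
  Blue x y = x ∈ X × y ∈ X × Any (λ g → x ∈ g × y ∈ g) T

  q : Fin n → ℕ
  q = wdeg (λ g → ∣ X ∩ g ∣ ∸ 1) T

  A⁻ : ∀ {g} → g ∈ₗ A → g ∈ₗ edges h × Inside g
  A⁻ = ∈-filter⁻ inside? {xs = edges h}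

  B⁻ : ∀ {g} → g ∈ₗ B → g ∈ₗ edges H × Inside g
  B⁻ = ∈-filter⁻ inside? {xs = edges H}

  T⁻ : ∀ {g} → g ∈ₗ T → g ∈ₗ edges h × Touching g
  T⁻ = ∈-filter⁻ touching? {xs = edges h}

  touching : ∀ {x y g} → x ∈ X → y ∈ X → y ≢ x → x ∈ g → y ∈ g → g ∈ₗ edges h → ¬ Inside g → Blue x y
  touching x∈X y∈X y≢x x∈g y∈g g∈h ¬in = x∈X , y∈X , LM.lose
    (∈-filter⁺ touching? g∈h (¬in , 2≤∣p∣ (x∈p∩q⁺ (x∈X , x∈g)) (x∈p∩q⁺ (y∈X , y∈g)) y≢x)) (x∈g , y∈g)

  configuration : Configuration m q Blue A B
  configuration = record
    { blue?    = λ x y → x ∈? X ×-dec y ∈? X ×-dec Any.any? (λ g → x ∈? g ×-dec y ∈? g) T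
    ; blue-sym = λ (x∈X , y∈X , xy) → y∈X , x∈X , Any.map (λ (x∈g , y∈g) → y∈g , x∈g) xy
    ; blue≤q   = blue≤q
    ; uniqueᴬ  = Unique.filter⁺ inside? (unique h)
    ; uniqueᴮ  = Unique.filter⁺ inside? (unique H)
    ; sizeᴬ    = All.lookup uniform-h ∘ proj₁ ∘ A⁻
    ; sizeᴮ    = All.lookup uniform-H ∘ proj₁ ∘ B⁻
    ; coverᴬ   = coverᴬ
    ; coverᴮ   = coverᴮ
    ; privateᴬ = privateᴬ
    ; privateᴮ = privateᴮ
    ; other    = other
    }
    where
    blue≤q : ∀ x (Y : Subset n) → (∀ {y} → y ∈ Y → y ≢ x × Blue x y) → ∣ Y ∣ ≤ q x
    blue≤q x Y Y-blue with x ∈? X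
    ... | yes x∈X = wdeg-cover X T x∈X Y λ y∈Y → let y≢x , _ , y∈X , xy = Y-blue y∈Y in y≢x , y∈X , xy
    ... | no  x∉X = ≮⇒≥ λ q<Y → x∉X (proj₁ (proj₂ (Y-blue (proj₂ (1≤∣p∣⇒∃ Y (≤-trans (s≤s z≤n) q<Y))))))

    coverᴬ : ∀ {g x y} → g ∈ₗ A → x ∈ g → y ∈ g → y ≢ x → Blue x y ⊎ ∃ λ b → b ∈ₗ B × x ∈ b × y ∈ b
    coverᴬ g∈A x∈g y∈g y≢x with g∈h , g-in ← A⁻ g∈A
      with _ , b , b∈H , x∈b , y∈b ← h→H (y≢x ∘ sym , _ , g∈h , x∈g , y∈g)
      with inside? b
    ... | yes b-in = inj₂ (b , ∈-filter⁺ inside? b∈H b-in , x∈b , y∈b)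
    ... | no ¬b-in = inj₁ (touching (g-in _ x∈g) (g-in _ y∈g) y≢x x∈b y∈b (outside-H⇒h b∈H ¬b-in) ¬b-in)

    coverᴮ : ∀ {g x y} → g ∈ₗ B → x ∈ g → y ∈ g → y ≢ x → Blue x y ⊎ ∃ λ a → a ∈ₗ A × x ∈ a × y ∈ a
    coverᴮ g∈B x∈g y∈g y≢x with g∈H , g-in ← B⁻ g∈B
      with _ , a , a∈h , x∈a , y∈a ← H→h (y≢x ∘ sym , _ , g∈H , x∈g , y∈g)
      with inside? a
    ... | yes a-in = inj₂ (a , ∈-filter⁺ inside? a∈h a-in , x∈a , y∈a)
    ... | no ¬a-in = inj₁ (touching (g-in _ x∈g) (g-in _ y∈g) y≢x x∈a y∈a a∈h ¬a-in)

    privateᴬ : ∀ {e} → e ∈ₗ A → ∃ λ x → ∃ λ y → x ∈ e × y ∈ e × y ≢ x × ¬ Blue x y ×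
               (∀ {g} → g ∈ₗ A → x ∈ g → y ∈ g → g ≡ e)
    privateᴬ e∈A with e∈h , e-in ← A⁻ e∈A with x , y , x∈e , y∈e , y≢x , only ← private-h e∈h =
      x , y , x∈e , y∈e , y≢x ,
      -- A touching hyperedge on the private pair would have to be `e`, which is inside `X`.
      (λ (_ , _ , xy) → let g , g∈T , x∈g , y∈g = LM.find xy ; g∈h , ¬g-in , _ = T⁻ g∈T in
        ¬g-in (subst Inside (sym (only g∈h x∈g y∈g)) e-in)) ,
      λ g∈A → only (proj₁ (A⁻ g∈A))

    privateᴮ : ∀ {e} → e ∈ₗ B → ∃ λ x → ∃ λ y → x ∈ e × y ∈ e × y ≢ x × ¬ Blue x y ×
               (∀ {g} → g ∈ₗ B → x ∈ g → y ∈ g → g ≡ e)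
    privateᴮ e∈B with e∈H , e-in ← B⁻ e∈B with x , y , x∈e , y∈e , y≢x , only ← private-H e∈H =
      x , y , x∈e , y∈e , y≢x ,
      (λ (_ , _ , xy) → let g , g∈T , x∈g , y∈g = LM.find xy ; g∈h , ¬g-in , _ = T⁻ g∈T in
        ¬g-in (subst Inside (sym (only (outside-h⇒H g∈h ¬g-in) x∈g y∈g)) e-in)) ,
      λ g∈B → only (proj₁ (B⁻ g∈B))

    other : ∀ {e x} → e ∈ₗ A → e ∈ₗ B → x ∈ e → ∃ λ g → x ∈ g × g ≢ e × (g ∈ₗ A ⊎ g ∈ₗ B)
    other e∈A e∈B x∈e with X-edge (proj₂ (A⁻ e∈A) _ x∈e)
    ... | g , x∈g , inj₁ (g∈A , g∉H) = g , x∈g , (λ { refl → g∉H (proj₁ (B⁻ e∈B)) }) , inj₁ g∈A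
    ... | g , x∈g , inj₂ (g∈B , g∉h) = g , x∈g , (λ { refl → g∉h (proj₁ (A⁻ e∈A)) }) , inj₂ g∈B

  1≤t : ∀ {x} → x ∈ X → 1 ≤ deg A x + deg B x
  1≤t x∈X with X-edge x∈X
  ... | g , x∈g , inj₁ (g∈A , _) = ≤-trans (1≤deg g∈A x∈g) (m≤m+n _ _)
  ... | g , x∈g , inj₂ (g∈B , _) = ≤-trans (1≤deg g∈B x∈g) (m≤n+m _ _)

  -- Hyperedges of `h` not inside `X` all belong to `H`, so `H` has at least as many of them, while
  -- in total it has at most as many hyperedges as `h`.
  ∣B∣≤∣A∣ : length B ≤ length A
  ∣B∣≤∣A∣ = +-cancelʳ-≤ (length A′) (length B) (length A) (begin
    length B + length A′ ≤⟨ +-monoʳ-≤ (length B) A′≤B′ ⟩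
    length B + length B′ ≡⟨ length-filter+ inside? (edges H) ⟩
    e H                  ≤⟨ eH≤eh ⟩
    e h                  ≡⟨ length-filter+ inside? (edges h) ⟨
    length A + length A′ ∎)
    where
    open ≤-Reasoning
    A′ B′ : List (Subset n)
    A′ = filter (¬? ∘ inside?) (edges h)
    B′ = filter (¬? ∘ inside?) (edges H)
    A′≤B′ : length A′ ≤ length B′
    A′≤B′ = unique-⊆⇒length≤ (Unique.filter⁺ (¬? ∘ inside?) (unique h)) λ g∈ →
      let g∈h , ¬in = ∈-filter⁻ (¬? ∘ inside?) {xs = edges h} g∈ in
      ∈-filter⁺ (¬? ∘ inside?) (outside-h⇒H g∈h ¬in) ¬in

  -- If `X` were empty, no hyperedge could lie in only one of `h` and `H`, as hyperedges have
  -- vertices.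
  X-nonempty : 1 ≤ ∣ X ∣
  X-nonempty with 1 ≤? ∣ X ∣
  ... | yes le = le
  ... | no ¬le = ⊥-elim (h≁H λ f → mk⇔
    (λ f∈h → decidable-stable (f ∈ₗ? edges H) λ f∉H → absurd (All.lookup uniform-h f∈h) (Δ₁-inside f∈h f∉H))
    (λ f∈H → decidable-stable (f ∈ₗ? edges h) λ f∉h → absurd (All.lookup uniform-H f∈H) (Δ₂-inside f∈H f∉h)))
    where
    absurd : ∀ {f} → ∣ f ∣ ≡ 3 + m → ¬ Inside f
    absurd {f} ∣f∣≡ f-in = ¬le (≤-trans (subst (1 ≤_) (sym ∣f∣≡) (s≤s z≤n)) (p⊆q⇒∣p∣≤∣q∣ {p = f} (f-in _)))

  K : SubHypergraph h
  K = record
    { verts    = spanned X T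
    ; kedges   = A ++ T
    ; kunique  = Unique.++⁺ (Unique.filter⁺ inside? (unique h)) (Unique.filter⁺ touching? (unique h))
                   λ (g∈A , g∈T) → proj₁ (proj₂ (T⁻ g∈T)) (proj₂ (A⁻ g∈A))
    ; kedges⊆  = All.++⁺ (All.tabulate (proj₁ ∘ A⁻)) (All.tabulate (proj₁ ∘ T⁻))
    ; kedgesIn = All.++⁺ (All.tabulate λ g∈A x∈g → ⊆spanned X T (proj₂ (A⁻ g∈A) _ x∈g))
                         (All.tabulate λ g∈T → edge⊆spanned X g∈T)
    ; nonempty = >-nonZero (≤-trans X-nonempty (p⊆q⇒∣p∣≤∣q∣ (⊆spanned X T)))
    }

  touching-bound : ∀ {g} → g ∈ₗ T → 2 * (N m * ∣ g ─ X ∣) + 3 * ((∣ X ∩ g ∣ ∸ 1) * (∣ X ∩ g ∣ * 1)) ≤ 2 * M m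
  touching-bound {g} g∈T with g∈h , ¬in , 2≤ ← T⁻ g∈T = trace-bound {m = m} 2≤ 1≤
    (trans (∣p∩q∣+∣q─p∣≡∣q∣ X g) (All.lookup uniform-h g∈h))
    where
    1≤ : 1 ≤ ∣ g ─ X ∣
    1≤ with 1 ≤? ∣ g ─ X ∣
    ... | yes le = le
    ... | no ¬le = ⊥-elim (¬in λ x x∈g → decidable-stable (x ∈? X) λ x∉X → ¬le (x∈p⇒1≤∣p∣ (x∈p∧x∉q⇒x∈p─q x∈g x∉X)))

  -- Double counting: a member of `T` with s vertices in `X` contributes s - 1 at each of them.
  S-q : S X q ≡ ∑ T (λ g → (∣ X ∩ g ∣ ∸ 1) * (∣ X ∩ g ∣ * 1))
  S-q = begin
    S X q                                                  ≡⟨ S-cong X (λ x → *-identityʳ (q x)) ⟨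
    S X (λ x → q x * 1)                                    ≡⟨ S-wdeg _ T X (λ _ → 1) ⟩
    ∑ T (λ g → (∣ X ∩ g ∣ ∸ 1) * S (X ∩ g) (λ _ → 1))      ≡⟨ ∑-cong T (λ g → cong ((∣ X ∩ g ∣ ∸ 1) *_) (S-const (X ∩ g) 1)) ⟩
    ∑ T (λ g → (∣ X ∩ g ∣ ∸ 1) * (∣ X ∩ g ∣ * 1))          ∎
    where open ≡-Reasoning

  -- A member of `T` has a budget of 2 M. It pays 2 N for each of its vertices outside `X` and,
  -- through `S X q`, 3(s - 1) to each of its s vertices in `X`; `trace-bound` says that the budget
  -- suffices.
  dense : Dense m h
  dense = K , *-cancelˡ-≤ 2 (begin
    2 * (N m * ∣ spanned X T ∣)
      ≤⟨ *-monoʳ-≤ 2 (*-monoʳ-≤ (N m) (∣spanned∣ X T)) ⟩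
    2 * (N m * (∣ X ∣ + ∑ T r))
      ≡⟨ eq₁ (N m) ∣ X ∣ (∑ T r) ⟩
    2 * (N m * ∣ X ∣) + 2 * (N m * ∑ T r)
      ≤⟨ +-monoˡ-≤ (2 * (N m * ∑ T r)) (total-bound configuration X 1≤t ∣B∣≤∣A∣) ⟩
    2 * (length A * M m) + 3 * S X q + 2 * (N m * ∑ T r)
      ≡⟨ cong (λ s → 2 * (length A * M m) + 3 * s + 2 * (N m * ∑ T r)) S-q ⟩
    2 * (length A * M m) + 3 * ∑ T s + 2 * (N m * ∑ T r)
      ≡⟨ eq₂ (2 * (length A * M m)) _ _ ⟩
    2 * (length A * M m) + (2 * (N m * ∑ T r) + 3 * ∑ T s)
      ≡⟨ cong (2 * (length A * M m) +_) (∑-linear T) ⟨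
    2 * (length A * M m) + ∑ T (λ g → 2 * (N m * r g) + 3 * s g)
      ≤⟨ +-monoʳ-≤ (2 * (length A * M m)) (∑-bound T (2 * M m) touching-bound) ⟩
    2 * (length A * M m) + length T * (2 * M m)
      ≡⟨ eq₃ (length A) (length T) (M m) ⟩
    2 * (M m * (length A + length T))
      ≡⟨ cong (λ l → 2 * (M m * l)) (List.length-++ A) ⟨
    2 * (M m * length (A ++ T)) ∎)
    where
    open ≤-Reasoning
    r s : Subset n → ℕ
    r g = ∣ g ─ X ∣
    s g = (∣ X ∩ g ∣ ∸ 1) * (∣ X ∩ g ∣ * 1)
    eq₁ : ∀ N x y → 2 * (N * (x + y)) ≡ 2 * (N * x) + 2 * (N * y)
    eq₁ = solve-∀
    eq₂ : ∀ a b c → a + b + c ≡ a + (c + b)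
    eq₂ = solve-∀
    eq₃ : ∀ a t M → 2 * (a * M) + t * (2 * M) ≡ 2 * (M * (a + t))
    eq₃ = solve-∀
    ∑-linear : ∀ L → ∑ L (λ g → 2 * (N m * r g) + 3 * s g) ≡ 2 * (N m * ∑ L r) + 3 * ∑ L s
    ∑-linear []      = sym (trans (+-identityʳ _) (trans (cong (2 *_) (*-zeroʳ (N m))) refl))
    ∑-linear (g ∷ L) = trans (cong (2 * (N m * r g) + 3 * s g +_) (∑-linear L)) (eq₄ (N m) (r g) (s g) (∑ L r) (∑ L s))
      where
      eq₄ : ∀ N r s R S → (2 * (N * r) + 3 * s) + (2 * (N * R) + 3 * S) ≡ 2 * (N * (r + R)) + 3 * (s + S)
      eq₄ = solve-∀

-- Reduction to irredundant preimages

module _ {n : ℕ} where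

  private? : (L : List (Subset n)) (e : Subset n) → Dec (Private L e)
  private? L e = map′
    (λ (x , y , x∈e , y∈e , y≢x , only) → x , y , x∈e , y∈e , y≢x , λ g∈L x∈g y∈g → All.lookup only g∈L (x∈g , y∈g))
    (λ (x , y , x∈e , y∈e , y≢x , only) → x , y , x∈e , y∈e , y≢x , All.tabulate λ g∈L (x∈g , y∈g) → only g∈L x∈g y∈g)
    (Fin.any? λ x → Fin.any? λ y → x ∈? e ×-dec y ∈? e ×-dec ¬? (y Fin.≟ x) ×-dec
      All.all? (λ g → (x ∈? g ×-dec y ∈? g) →-dec (g ≟ₛ e)) L)

  remove : Hypergraph n → Subset n → Hypergraph n
  remove h f = hyp (filter (¬? ∘ (_≟ₛ f)) (edges h)) (Unique.filter⁺ (¬? ∘ (_≟ₛ f)) (unique h))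

  module _ {h : Hypergraph n} {f : Subset n} where

    remove⊆ : ∀ {g} → g ∈ₗ edges (remove h f) → g ∈ₗ edges h
    remove⊆ = proj₁ ∘ ∈-filter⁻ (¬? ∘ (_≟ₛ f)) {xs = edges h}

    e-remove : f ∈ₗ edges h → e (remove h f) < e h
    e-remove f∈h = List.filter-notAll (¬? ∘ (_≟ₛ f)) (edges h) (Any.map (λ { refl ¬refl → ¬refl refl }) f∈h)

    -- A pair of `f` covered by no other hyperedge would be private to `f`.
    remove-proj : ¬ Private (edges h) f → ∀ {i j} → ProjAdj h i j → ProjAdj (remove h f) i j
    remove-proj ¬priv {i} {j} (i≢j , g , g∈h , i∈g , j∈g) with g ≟ₛ f
    ... | no g≢f = i≢j , g , ∈-filter⁺ (¬? ∘ (_≟ₛ f)) g∈h g≢f , i∈g , j∈g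
    ... | yes refl with Any.any? (λ k → i ∈? k ×-dec j ∈? k ×-dec ¬? (k ≟ₛ f)) (edges h)
    ...   | yes w with k , k∈h , i∈k , j∈k , k≢f ← LM.find w =
      i≢j , k , ∈-filter⁺ (¬? ∘ (_≟ₛ f)) k∈h k≢f , i∈k , j∈k
    ...   | no ¬w = ⊥-elim (¬priv (i , j , i∈g , j∈g , i≢j ∘ sym , λ {k} k∈h i∈k j∈k →
      decidable-stable (k ≟ₛ f) λ k≢f → ¬w (LM.lose k∈h (i∈k , j∈k , k≢f))))

    remove-preimage : ∀ {d G} → ¬ Private (edges h) f → Preimage d h G → Preimage d (remove h f) G
    remove-preimage ¬priv (uniform , proj) =
      All.tabulate (All.lookup uniform ∘ remove⊆) , λ i j → mk⇔
        (remove-proj ¬priv ∘ Equivalence.to (proj i j))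
        (λ (i≢j , g , g∈ , ij) → Equivalence.from (proj i j) (i≢j , g , remove⊆ g∈ , ij))

    remove-dense : ∀ {m} → Dense m (remove h f) → Dense m h
    remove-dense (K , le) = record
      { verts = verts K ; kedges = kedges K ; kunique = kunique K
      ; kedges⊆ = All.map remove⊆ (kedges⊆ K) ; kedgesIn = kedgesIn K ; nonempty = nonempty K } , le

  irredundant? : (h : Hypergraph n) →
    (∀ {f} → f ∈ₗ edges h → Private (edges h) f) ⊎ (∃ λ f → f ∈ₗ edges h × ¬ Private (edges h) f)
  irredundant? h with All.all? (private? (edges h)) (edges h)
  ... | yes all = inj₁ (All.lookup all)
  ... | no ¬all = inj₂ (LM.find (All.¬All⇒Any¬ (private? (edges h)) (edges h) ¬all))

  -- Removing a hyperedge without a private pair would leave a smaller preimage.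
  minimal⇒irredundant : ∀ {d H G} → MinimalPreimage d H G → ∀ {f} → f ∈ₗ edges H → Private (edges H) f
  minimal⇒irredundant {H = H} {G} (pre , minimal) {f} f∈H = decidable-stable (private? (edges H) f) λ ¬priv →
    <⇒≱ (e-remove {H} f∈H) (minimal (remove H f) (remove-preimage {H} {G = G} ¬priv pre))

  same? : (h H : Hypergraph n) → Dec (SameHypergraph h H)
  same? h H = map′
    (λ (h⊆H , H⊆h) f → mk⇔ (All.lookup h⊆H) (All.lookup H⊆h))
    (λ same → All.tabulate (Equivalence.to (same _)) , All.tabulate (Equivalence.from (same _)))
    (All.all? (_∈ₗ? edges H) (edges h) ×-dec All.all? (_∈ₗ? edges h) (edges H))

  -- The hypergraph `h` cannot agree with both of two distinct minimal preimages.
  other-minimal : ∀ {d G} → Ambiguous d G → (h : Hypergraph n) →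
    ∃ λ H → MinimalPreimage d H G × ¬ SameHypergraph h H
  other-minimal (H₁ , H₂ , min₁ , min₂ , H₁≁H₂) h with same? h H₁ | same? h H₂
  ... | no h≁H₁ | _        = H₁ , min₁ , h≁H₁
  ... | yes _   | no h≁H₂  = H₂ , min₂ , h≁H₂
  ... | yes h~H₁ | yes h~H₂ = ⊥-elim (H₁≁H₂ λ f → mk⇔
    (Equivalence.to (h~H₂ f) ∘ Equivalence.from (h~H₁ f))
    (Equivalence.to (h~H₁ f) ∘ Equivalence.from (h~H₂ f)))

  -- Induction on a bound `k` for the number of hyperedges: redundant ones are removed until
  -- `Comparison` applies, and the dense subhypergraph found then also lies in the original `h`.
  ambiguous⇒dense : ∀ {m G} → Ambiguous (3 + m) G → ∀ k (h : Hypergraph n) → e h ≤ k →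
    Preimage (3 + m) h G → Dense m h
  ambiguous⇒dense {m} {G} amb k h eh≤k pre with irredundant? h
  ambiguous⇒dense {m} {G} amb k h eh≤k pre@(uniform , proj) | inj₁ irredundant
    with H , min@((uniform′ , proj′) , minimal) , h≁H ← other-minimal amb h =
    Comparison.dense h H uniform uniform′
      (Equivalence.to (proj′ _ _) ∘ Equivalence.from (proj _ _))
      (Equivalence.to (proj _ _) ∘ Equivalence.from (proj′ _ _))
      irredundant (minimal⇒irredundant {3 + m} {H} {G} min) (minimal h pre) h≁H
  ambiguous⇒dense {G = G} amb zero    h eh≤k pre | inj₂ (f , f∈h , _) = ⊥-elim (<⇒≱ (e-remove {h} {f} f∈h) (≤-trans eh≤k z≤n))
  ambiguous⇒dense {m} {G} amb (suc k) h eh≤k pre | inj₂ (f , f∈h , ¬priv) = remove-dense {h} {m = m}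
    (ambiguous⇒dense {m} {G} amb k (remove h f) (≤-pred (≤-trans (e-remove {h} f∈h) eh≤k)) (remove-preimage {h} {G = G} ¬priv pre))

-- Rational arithmetic

open import Data.Integer using (+_)
import Data.Integer as ℤ
import Data.Integer.Properties as ℤ
open import Data.Rational using (ℚ; Positive; 1/_)
import Data.Rational as ℚ
open import Data.Rational.Properties using (pos⇒nonZero)
import Data.Rational.Properties as ℚ
import Data.Rational.Unnormalised as ℚᵘ
import Data.Rational.Unnormalised.Properties as ℚᵘ

fraction≤⁻ : ∀ a {v} .{{_ : NonZero v}} (q : ℚ) → 1 ≤ v → (+ a) ℚ./ v ℚ.≤ q → (+ a) ℤ.* ℚ.↧ q ℤ.≤ ℚ.↥ q ℤ.* (+ v)
fraction≤⁻ a {suc v} q@record{} _ le = ℚᵘ.drop-*≤* (ℚᵘ.≤-respˡ-≃ (ℚ.toℚᵘ-fromℚᵘ (ℚᵘ.mkℚᵘ (+ a) v)) (ℚ.toℚᵘ-mono-≤ le))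

-- Passing to unnormalised fractions avoids cancelling common factors, so the claim becomes a
-- cross-multiplied inequality in ℕ.
fraction-+-≤ : ∀ a b c d f (s : ℚ) → ℚ.toℚᵘ s ≡ ℚᵘ.mkℚᵘ (+ c) d →
  (a * suc d + c * suc b) * 1 ≤ f * (suc b * suc d) → (+ a) ℚ./ suc b ℚ.+ s ℚ.≤ (+ f) ℚ./ 1
fraction-+-≤ a b c d f s s≡ le = ℚ.toℚᵘ-cancel-≤
  (ℚᵘ.≤-respˡ-≃ (ℚᵘ.≃-sym (ℚᵘ.≃-trans (ℚ.toℚᵘ-homo-+ ((+ a) ℚ./ suc b) s)
      (ℚᵘ.+-cong (ℚ.toℚᵘ-fromℚᵘ (ℚᵘ.mkℚᵘ (+ a) b)) (ℚᵘ.≃-reflexive s≡))))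
    (ℚᵘ.≤-respʳ-≃ (ℚᵘ.≃-sym (ℚ.toℚᵘ-fromℚᵘ (ℚᵘ.mkℚᵘ (+ f) 0)))
      (ℚᵘ.*≤* (subst₂ ℤ._≤_ lhs (ℤ.pos-* f (suc b * suc d)) (ℤ.+≤+ le)))))
  where
  lhs : + ((a * suc d + c * suc b) * 1) ≡ ((+ a) ℤ.* (+ suc d) ℤ.+ (+ c) ℤ.* (+ suc b)) ℤ.* (+ 1)
  lhs = trans (ℤ.pos-* (a * suc d + c * suc b) 1) (cong (ℤ._* (+ 1)) (cong₂ ℤ._+_ (ℤ.pos-* a (suc d)) (ℤ.pos-* c (suc b))))

+≤⇒≤- : ∀ (p s r : ℚ) → p ℚ.+ s ℚ.≤ r → p ℚ.≤ r ℚ.- s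
+≤⇒≤- p s r le = subst (ℚ._≤ r ℚ.- s)
  (trans (ℚ.+-assoc p s (ℚ.- s)) (trans (cong (p ℚ.+_) (ℚ.+-inverseʳ s)) (ℚ.+-identityʳ p)))
  (ℚ.+-monoˡ-≤ (ℚ.- s) le)

-- Here q ≥ l / v ≥ N / M > 0, so 1 / q is at most M / N, and d - 1 - M / N is the claimed fraction.
density⇒bound : ∀ m v l (q : ℚ) .{{_ : NonZero v}} → 1 ≤ v → N m * v ≤ M m * l → (+ l) ℚ./ v ℚ.≤ q →
  Σ (ℚ.Positive q) λ pos →
  ((+ (2 * (3 + m) ∸ 4)) ℚ./ suc (2 * (2 + m))) ℚ.≤ ((+ (2 + m)) ℚ./ 1) ℚ.- (ℚ.1/ q) {{ℚ.pos⇒nonZero q {{pos}}}}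
density⇒bound m v zero q 1≤v Nv≤Ml _ = ⊥-elim (<⇒≱ (≤-trans 1≤v (m≤m+n v _)) (≤-trans Nv≤Ml (≤-reflexive (*-zeroʳ (M m)))))
-- A negative or zero `q` cannot bound l / v from above, since l ≥ 1.
density⇒bound m v@(suc _) l@(suc _) q@(ℚ.mkℚ ℤ.-[1+ _ ] _ _) 1≤v _ l/v≤q with fraction≤⁻ l {v} q 1≤v l/v≤q
... | ()
density⇒bound m v@(suc _) l@(suc _) q@(ℚ.mkℚ (+ zero) _ _) 1≤v _ l/v≤q with fraction≤⁻ l {v} q 1≤v l/v≤q
... | ℤ.+≤+ ()
density⇒bound m v@(suc _) l@(suc _) q@(ℚ.mkℚ (+ suc a) b _) 1≤v Nv≤Ml l/v≤q = _ ,
  +≤⇒≤- _ (ℚ.1/ q) _ (fraction-+-≤ (2 * (3 + m) ∸ 4) (2 * (2 + m)) (suc b) a (2 + m) (ℚ.1/ q) refl (begin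
    ((2 * (3 + m) ∸ 4) * suc a + suc b * suc (2 * (2 + m))) * 1
      ≡⟨ cong (λ k → (k * suc a + suc b * suc (2 * (2 + m))) * 1) (trans (cong (_∸ 4) (eq₁ m)) (m+n∸n≡m (2 * m + 2) 4)) ⟩
    ((2 * m + 2) * suc a + suc b * suc (2 * (2 + m))) * 1
      ≡⟨ eq₂ m (suc a) (suc b) ⟩
    (2 * m + 2) * suc a + N m * suc b
      ≤⟨ +-monoʳ-≤ ((2 * m + 2) * suc a) Nb≤Ma ⟩
    (2 * m + 2) * suc a + M m * suc a
      ≡⟨ eq₃ m (suc a) ⟩
    (2 + m) * (suc (2 * (2 + m)) * suc a) ∎))
  where
  open ≤-Reasoning
  eq₁ : ∀ m → 2 * (3 + m) ≡ 2 * m + 2 + 4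
  eq₁ = solve-∀
  eq₂ : ∀ m a b → ((2 * m + 2) * a + b * suc (2 * (2 + m))) * 1 ≡ (2 * m + 2) * a + (5 + 2 * m) * b
  eq₂ = solve-∀
  -- This is (2d - 4) + M = (d - 1)(2d - 1), the identity behind the constant in the theorem.
  eq₃ : ∀ m a → (2 * m + 2) * a + (suc m * (5 + 2 * m) + 3) * a ≡ (2 + m) * (suc (2 * (2 + m)) * a)
  eq₃ = solve-∀
  swap : ∀ x y z → x * y * z ≡ x * z * y
  swap = solve-∀
  lb≤av : l * suc b ≤ suc a * v
  lb≤av = ℤ.drop‿+≤+ (subst₂ ℤ._≤_ (sym (ℤ.pos-* l (suc b))) (sym (ℤ.pos-* (suc a) v)) (fraction≤⁻ l q 1≤v l/v≤q))
  Nb≤Ma : N m * suc b ≤ M m * suc a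
  Nb≤Ma = *-cancelʳ-≤ _ _ v (begin
    N m * suc b * v   ≡⟨ swap (N m) (suc b) v ⟩
    N m * v * suc b   ≤⟨ *-monoˡ-≤ (suc b) Nv≤Ml ⟩
    M m * l * suc b   ≡⟨ *-assoc (M m) l (suc b) ⟩
    M m * (l * suc b) ≤⟨ *-monoʳ-≤ (M m) lb≤av ⟩
    M m * (suc a * v) ≡⟨ *-assoc (M m) (suc a) v ⟨
    M m * suc a * v   ∎)

theorem16 : (d : ℕ) → d ≥ 3 → (n : ℕ) → (G : Graph n) → (h : Hypergraph n) →
    Preimage d h G → Ambiguous d G →
    (q : ℚ) → IsMaxDensity h q →
    Σ (Positive q) λ pos →
    ((+ (2 * d ∸ 4)) ℚ./ suc (2 * (d ∸ 1))) ℚ.≤ ((+ (d ∸ 1)) ℚ./ 1) ℚ.- (1/ q) {{pos⇒nonZero q {{pos}}}}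
theorem16 (suc (suc (suc m))) _ n G h pre amb q (_ , maximal)
  with K , dense ← ambiguous⇒dense {m = m} {G = G} amb (e h) h ≤-refl pre =
  density⇒bound m ∣ verts K ∣ (length (kedges K)) q {{nonempty K}} (>-nonZero⁻¹ ∣ verts K ∣ {{nonempty K}}) dense (maximal K)
theorem16 1 (s≤s ())
theorem16 2 (s≤s (s≤s ()))
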